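{- Let $p>2$ be a prime number, let $\alpha>2$ be an integer, let $\phi$ denote Euler's totient function, let $n=|V(\Gamma(\mathbb{Z}_{p^\alpha}))|$, and let $i$ be an integer with $0\leq i\leq n$. (i) If $\alpha$ is odd, put $$A=\sum_{1\leq r\leq\lfloor\alpha/2\rfloor,\ a\geq 1}\binom{\phi(p^r)}{a}\binom{n-\phi(p^r)-\sum_{k=1}^{r-1}\left(\phi(p^k)+\phi(p^{\alpha-k})\right)}{i-a-\sum_{k=1}^{r-1}\phi(p^{\alpha-k})}.$$ Then $d(\Gamma(\mathbb{Z}_{p^\alpha}),i)=A+1$ if $i=\sum_{k=1}^{\lfloor\alpha/2\rfloor}\phi(p^{\alpha-k})$, and $d(\Gamma(\mathbb{Z}_{p^\alpha}),i)=A$ otherwise. (ii) If $\alpha$ is even, put $$A=\sum_{1\leq r<\alpha/2,\ a\geq 1}\binom{\phi(p^r)}{a}\binom{n-\phi(p^r)-\sum_{k=1}^{r-1}\left(\phi(p^k)+\phi(p^{\alpha-k})\right)}{i-a-\sum_{k=1}^{r-1}\phi(p^{\alpha-k})}$$ and $$B=\sum_{a\geq 1,\ i=a+\sum_{k=1}^{(\alpha/2)-1}\phi(p^{\alpha-k})}\binom{\phi(p^{\alpha/2})}{a}.$$ Then $d(\Gamma(\mathbb{Z}_{p^\alpha}),i)=A$ if $i\leq\sum_{k=1}^{(\alpha/2)-1}\phi(p^{\alpha-k})$, and $d(\Gamma(\mathbb{Z}_{p^\alpha}),i)=A+B$ otherwise.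
   Context: For a positive integer $m$, the zero-divisor graph $\Gamma(\mathbb{Z}_m)$ is the simple undirected loopless graph whose vertices are the nonzero zero-divisors of the ring $\mathbb{Z}_m$ of integers modulo $m$, two distinct vertices $u,v$ being adjacent if and only if $uv=0$ in $\mathbb{Z}_m$. For a finite simple graph $G$ with vertex set $V(G)$, a set $S\subseteq V(G)$ is a dominating set if every vertex of $V(G)\setminus S$ is adjacent to at least one vertex of $S$, and $d(G,i)$ is the number of dominating sets of $G$ of cardinality $i$. Summation indices are integers satisfying the displayed constraints, an empty sum is $0$, and a binomial coefficient $\binom{m}{j}$ (with $m\ge 0$) is $0$ when $j<0$ or $j>m$. (In $B$ the only possible index is $a=i-\sum_{k=1}^{(\alpha/2)-1}\phi(p^{\alpha-k})$.) -}

module Defs where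

open import Data.Bool.Base using (if_then_else_)
open import Data.Fin.Base using (Fin; toℕ)
open import Data.Fin.Properties using (all?; any?; nonZeroIndex) renaming (_≟_ to _≟ᶠ_)
open import Data.Fin.Subset using (Subset; inside; outside; _∈_; _∉_; _⊆_; ∣_∣)
open import Data.Fin.Subset.Properties using (_∈?_; _⊆?_)
open import Data.Integer.Base using (ℤ; +_; -[1+_])
open import Data.List.Base using (List; []; _∷_; _++_; map; filter; length; applyUpTo)
open import Data.Nat.Base using (ℕ; zero; suc; _*_)
open import Data.Nat.Combinatorics using (_C_)
open import Data.Nat.Coprimality using (Coprime; coprime?)
open import Data.Nat.DivMod using (_mod_)
open import Data.Nat.ListAction using (sum)
open import Data.Nat.Properties using (*-comm; _≟_)
open import Data.Product.Base using (_×_; _,_; ∃)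
open import Data.Vec.Base as Vec using (tabulate)
open import Relation.Binary.Definitions using (Decidable; Symmetric)
open import Relation.Binary.PropositionalEquality using (_≡_; _≢_; refl; sym; trans; cong)
open import Relation.Nullary using (Dec; does; ¬_; ¬?; _×-dec_; _→-dec_)

-- A finite simple graph whose vertex set V is a subset of an ambient finite
-- set Fin size.  Only the restriction of the relation _~_ to V matters.
record SimpleGraph : Set₁ where
  field
    size   : ℕ
    V      : Subset size
    _~_    : Fin size → Fin size → Set
    _~?_   : Decidable _~_
    ~-sym  : Symmetric _~_
    irrefl : ∀ {v} → ¬ (v ~ v)

module _ (G : SimpleGraph) where
  open SimpleGraph G

  order : ℕ
  order = ∣ V ∣

  IsDominating : Subset size → Set
  IsDominating S =
    S ⊆ V × (∀ v → v ∈ V → v ∉ S → ∃ λ u → u ∈ S × v ~ u)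

  isDominating? : ∀ S → Dec (IsDominating S)
  isDominating? S =
    (S ⊆? V) ×-dec
    all? (λ v → (v ∈? V) →-dec (¬? (v ∈? S) →-dec
      any? (λ u → (u ∈? S) ×-dec (v ~? u))))

-- Each subset of Fin n, listed exactly once.
allSubsets : ∀ n → List (Subset n)
allSubsets zero    = Vec.[] ∷ []
allSubsets (suc n) =
  map (outside Vec.∷_) (allSubsets n) ++ map (inside Vec.∷_) (allSubsets n)

d : SimpleGraph → ℕ → ℕ
d G i = length (filter (λ S → isDominating? G S ×-dec (∣ S ∣ ≟ i))
                       (allSubsets (SimpleGraph.size G)))

-- ℤ/m is represented by Fin m, with multiplication of residues modulo m.
module _ {m : ℕ} where

  infixl 7 _·_
  _·_ : Fin m → Fin m → Fin m
  x · y = _mod_ (toℕ x * toℕ y) m {{nonZeroIndex x}}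

  ·-comm : ∀ x y → x · y ≡ y · x
  ·-comm x y = cong (λ k → _mod_ k m {{nonZeroIndex x}}) (*-comm (toℕ x) (toℕ y))

  IsZero : Fin m → Set
  IsZero x = toℕ x ≡ 0

  isZero? : ∀ x → Dec (IsZero x)
  isZero? x = toℕ x ≟ 0

  IsNonzeroZeroDivisor : Fin m → Set
  IsNonzeroZeroDivisor x = ¬ IsZero x × ∃ λ y → ¬ IsZero y × IsZero (x · y)

  isNonzeroZeroDivisor? : ∀ x → Dec (IsNonzeroZeroDivisor x)
  isNonzeroZeroDivisor? x =
    ¬? (isZero? x) ×-dec any? (λ y → ¬? (isZero? y) ×-dec isZero? (x · y))

Γ : ℕ → SimpleGraph
Γ m = record
  { size   = m
  ; V      = tabulate (λ x → does (isNonzeroZeroDivisor? x))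
  ; _~_    = λ u v → u ≢ v × IsZero (u · v)
  ; _~?_   = λ u v → ¬? (u ≟ᶠ v) ×-dec isZero? (u · v)
  ; ~-sym  = λ {u} {v} (u≢v , uv≡0) →
               (λ v≡u → u≢v (sym v≡u)) , trans (cong toℕ (·-comm v u)) uv≡0
  ; irrefl = λ (v≢v , _) → v≢v refl
  }

-- Euler's totient: the number of k with 1 ≤ k ≤ n and k coprime to n.
φ : ℕ → ℕ
φ n = length (filter (λ k → coprime? k n) (applyUpTo suc n))

-- f 1 + f 2 + ⋯ + f n
∑₁ : ℕ → (ℕ → ℕ) → ℕ
∑₁ n f = sum (applyUpTo (λ k → f (suc k)) n)

infix 5 ∑₁
syntax ∑₁ n (λ k → e) = ∑[1≤ k ≤ n ] e

-- Zero when j < 0 or j > m.  A negative upper argument is outside the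
-- convention (and does not arise in the theorem); it is given the value 0.
binom : ℤ → ℤ → ℕ
binom (+ m) (+ j) = m C j
binom _     _     = 0

when : ∀ {P : Set} → Dec P → ℕ → ℕ
when P? e = if does P? then e else 0

{-# OPTIONS --safe #-}

-- Let ℓ x be the p-adic valuation of x modulo p^α.  The vertices are the x with 1 ≤ ℓ x < α, there
-- are φ(p^(α−k)) of them with ℓ x = k, and distinct u, v are adjacent iff α ≤ ℓ u + ℓ v.  Classify
-- a dominating set S by the least r ≥ 1 for which S meets level α − r.  Since S misses the levels
-- above α − r, the vertices of level < r have no neighbour in S and must all lie in S; conversely
-- any element of level α − r dominates every vertex of level ≥ r.  So S is given by a ≥ 1 elements
-- of level α − r and an arbitrary set of vertices of the levels r, …, α − r − 1.
-- If S meets no level α − r with r ≤ ⌊α/2⌋, then α is odd and S consists of all levels ≤ ⌊α/2⌋.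

module Submission where

open import Defs
open import Algebra.Properties.CommutativeSemigroup using (interchange)
open import Data.Bool.Base using (true; false; if_then_else_)
open import Data.Empty using (⊥)
open import Data.Fin.Base using (Fin; toℕ; fromℕ<; zero; suc)
open import Data.Fin.Properties using (all?; any?; toℕ<n; toℕ-fromℕ<; toℕ-injective; nonZeroIndex) renaming (_≟_ to _≟ᶠ_; suc-injective to sucᶠ-injective)
open import Data.Fin.Subset using (Subset; inside; outside; _∈_; _∉_; ∣_∣)
open import Data.Fin.Subset.Properties using (_∈?_)
open import Data.Integer.Base as ℤ using (+_; _-_; _⊖_)
import Data.Integer.Properties as ℤ
open import Data.List.Base using (List; []; _∷_; _++_; map; filter; length; applyUpTo)
open import Data.List.Properties using (map-++; map-∘; map-cong; map-applyUpTo)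
open import Data.Nat.Base using (ℕ; zero; suc; _+_; _*_; _∸_; _^_; _≤_; _<_; _>_; z≤n; s≤s; NonZero; ≢-nonZero; nonTrivial⇒n>1)
open import Data.Nat.Combinatorics using (_C_; k>n⇒nCk≡0; nCn≡1; nCk+nC[k+1]≡[n+1]C[k+1])
open import Data.Nat.Coprimality using (Coprime; coprime?; coprime-divisor)
open import Data.Nat.Divisibility
open import Data.Nat.DivMod using (_/_; _%_; m%n<n; m≡m%n+[m/n]*n)
import Data.Nat.ListAction as List
open import Data.Nat.ListAction.Properties using (sum-++)
open import Data.Nat.Primality using (Prime; euclidsLemma; prime⇒irreducible; prime⇒nonZero; prime⇒nonTrivial)
open import Data.Nat.Properties
open import Data.Product.Base using (_×_; _,_; ∃; proj₁; proj₂)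
open import Data.Sum.Base using (_⊎_; inj₁; inj₂)
open import Data.Vec.Base as Vec using ()
open import Data.Vec.Properties using (lookup⇒[]=; []=⇒lookup; lookup∘tabulate)
open import Function.Base using (_∘_)
open import Relation.Binary.PropositionalEquality
open import Relation.Nullary using (Dec; yes; no; does; ¬_; ¬?; _×-dec_; _→-dec_; contradiction)
open import Relation.Nullary.Decidable using (dec-true; dec-false)

open import Algebra.Properties.CommutativeMonoid.Sum +-0-commutativeMonoid
  using (sum; sum-syntax; sum-cong-≗; sum-replicate-zero; ∑-distrib-+; ∑-comm)
open import Algebra.Properties.CommutativeMonoid.Sum *-1-commutativeMonoid
  using () renaming (sum to ∏; sum-cong-≗ to ∏-cong)

private
  variable
    P Q R : Set
    k n : ℕ

-- Indicators of decidable propositions and their sums.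

⟦_⟧ : Dec P → ℕ
⟦ P? ⟧ = when P? 1

⟦⟧-true : (P? : Dec P) → P → ⟦ P? ⟧ ≡ 1
⟦⟧-true P? p = cong (if_then 1 else 0) (dec-true P? p)

⟦⟧-false : (P? : Dec P) → ¬ P → ⟦ P? ⟧ ≡ 0
⟦⟧-false P? ¬p = cong (if_then 1 else 0) (dec-false P? ¬p)

⟦⟧-cong : (P? : Dec P) (Q? : Dec Q) → (P → Q) → (Q → P) → ⟦ P? ⟧ ≡ ⟦ Q? ⟧
⟦⟧-cong P? (yes q) f g = ⟦⟧-true P? (g q)
⟦⟧-cong P? (no ¬q) f g = ⟦⟧-false P? (¬q ∘ f)

⟦⟧-× : (P? : Dec P) (Q? : Dec Q) → ⟦ P? ×-dec Q? ⟧ ≡ ⟦ P? ⟧ * ⟦ Q? ⟧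
⟦⟧-× (yes _) Q? = sym (*-identityˡ ⟦ Q? ⟧)
⟦⟧-× (no _)  Q? = refl

⟦⟧-split : (P? : Dec P) (Q? : Dec Q) (R? : Dec R) →
           (P → Q ⊎ R) → (Q → P) → (R → P) → ¬ (Q × R) → ⟦ P? ⟧ ≡ ⟦ Q? ⟧ + ⟦ R? ⟧
⟦⟧-split P? (yes q) R? f g h d =
  trans (⟦⟧-true P? (g q)) (cong suc (sym (⟦⟧-false R? λ r → d (q , r))))
⟦⟧-split P? (no ¬q) R? f g h d = ⟦⟧-cong P? R? (λ p → case (f p)) h
  where
  case : _ → _
  case (inj₁ q) = contradiction q ¬q
  case (inj₂ r) = r

∑-zero : {f : Fin n → ℕ} → (∀ x → f x ≡ 0) → sum f ≡ 0
∑-zero {n} f≡0 = trans (sum-cong-≗ f≡0) (sum-replicate-zero n)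

∑≡0⇒ : {f : Fin n → ℕ} → sum f ≡ 0 → ∀ x → f x ≡ 0
∑≡0⇒ {suc n} {f} eq zero    = m+n≡0⇒m≡0 (f zero) eq
∑≡0⇒ {suc n} {f} eq (suc x) = ∑≡0⇒ (m+n≡0⇒n≡0 (f zero) eq) x

⟦⟧≡0⇒ : (P? : Dec P) → ⟦ P? ⟧ ≡ 0 → ¬ P
⟦⟧≡0⇒ (no ¬p) _ = ¬p

-- The device behind every double count below: an existence statement with a unique witness becomes
-- a sum over the candidate witnesses, whose order of summation can then be exchanged.
∑-unique : {W : Fin n → Set} (P? : Dec P) (W? : ∀ x → Dec (W x)) →
           (P → ∃ W) → (∀ {x} → W x → P) → (∀ {x y} → W x → W y → x ≡ y) →
           ⟦ P? ⟧ ≡ ∑[ x < n ] ⟦ W? x ⟧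
∑-unique {zero}  P? W? ex out uniq = ⟦⟧-false P? λ p → case (ex p)
  where
  case : ∃ _ → ⊥
  case (() , _)
∑-unique {suc n} {W = W} P? W? ex out uniq = trans
  (⟦⟧-split P? (W? zero) (any? (W? ∘ suc)) (split ∘ ex) out (λ (_ , w) → out w)
    λ (w , _ , w′) → contradiction (uniq w w′) λ ())
  (cong₂ _+_ refl (∑-unique (any? (W? ∘ suc)) (W? ∘ suc) (λ e → e) (λ w → _ , w)
    (λ w w′ → sucᶠ-injective (uniq w w′))))
  where
  split : ∃ W → W zero ⊎ ∃ (W ∘ suc)
  split (zero  , w) = inj₁ w
  split (suc x , w) = inj₂ (x , w)

⟦all⟧≡∏⟦⟧ : {W : Fin n → Set} (W? : ∀ x → Dec (W x)) → ⟦ all? W? ⟧ ≡ ∏ (λ x → ⟦ W? x ⟧)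
⟦all⟧≡∏⟦⟧ {zero}  W? = refl
⟦all⟧≡∏⟦⟧ {suc n} W? = trans
  (⟦⟧-cong (all? W?) (W? zero ×-dec all? (W? ∘ suc)) (λ w → w zero , λ x → w (suc x))
    λ { (w , ws) zero → w ; (w , ws) (suc x) → ws x })
  (trans (⟦⟧-× (W? zero) (all? (W? ∘ suc))) (cong (⟦ W? zero ⟧ *_) (⟦all⟧≡∏⟦⟧ (W? ∘ suc))))

-- Sums over lists and over all subsets.

∑∈ : {A : Set} → List A → (A → ℕ) → ℕ
∑∈ xs f = List.sum (map f xs)

module _ {A : Set} where

  ∑∈-cong : (xs : List A) {f g : A → ℕ} → (∀ x → f x ≡ g x) → ∑∈ xs f ≡ ∑∈ xs g
  ∑∈-cong xs eq = cong List.sum (map-cong eq xs)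

  ∑∈-+ : (xs : List A) (f g : A → ℕ) → ∑∈ xs (λ x → f x + g x) ≡ ∑∈ xs f + ∑∈ xs g
  ∑∈-+ []       f g = refl
  ∑∈-+ (x ∷ xs) f g = trans (cong₂ _+_ refl (∑∈-+ xs f g))
    (interchange +-commutativeSemigroup (f x) (g x) _ _)

  ∑∈-0 : (xs : List A) → ∑∈ xs (λ _ → 0) ≡ 0
  ∑∈-0 []       = refl
  ∑∈-0 (x ∷ xs) = ∑∈-0 xs

  ∑∈-∑-comm : (xs : List A) (f : Fin n → A → ℕ) →
              ∑∈ xs (λ x → ∑[ k < n ] f k x) ≡ ∑[ k < n ] ∑∈ xs (f k)
  ∑∈-∑-comm {n = n} []       f = sym (sum-replicate-zero n)
  ∑∈-∑-comm         (x ∷ xs) f = trans (cong₂ _+_ refl (∑∈-∑-comm xs f)) (sym (∑-distrib-+ (λ k → f k x) (λ k → ∑∈ xs (f k))))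

  length-filter : {W : A → Set} (W? : ∀ x → Dec (W x)) (xs : List A) →
                  length (filter W? xs) ≡ ∑∈ xs (λ x → ⟦ W? x ⟧)
  length-filter W? []       = refl
  length-filter W? (x ∷ xs) with does (W? x)
  ... | true  = cong suc (length-filter W? xs)
  ... | false = length-filter W? xs

∑ˢ : ∀ n → (Subset n → ℕ) → ℕ
∑ˢ n = ∑∈ (allSubsets n)

∑ˢ-suc : (f : Subset (suc n) → ℕ) →
         ∑ˢ (suc n) f ≡ ∑ˢ n (f ∘ (outside Vec.∷_)) + ∑ˢ n (f ∘ (inside Vec.∷_))
∑ˢ-suc {n} f = begin
  List.sum (map f (map out xs ++ map ins xs))        ≡⟨ cong List.sum (map-++ f (map out xs) _) ⟩
  List.sum (map f (map out xs) ++ map f (map ins xs)) ≡⟨ sum-++ (map f (map out xs)) _ ⟩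
  ∑∈ (map out xs) f + ∑∈ (map ins xs) f              ≡⟨ cong₂ (λ ys zs → List.sum ys + List.sum zs) (map-∘ xs) (map-∘ xs) ⟨
  ∑∈ xs (f ∘ out) + ∑∈ xs (f ∘ ins)                  ∎
  where
  open ≡-Reasoning
  xs = allSubsets n
  out = outside Vec.∷_
  ins = inside Vec.∷_

-- Counting subsets by the number of elements of each colour

hits : (Fin n → Fin k) → Subset n → Fin k → ℕ
hits {n} ρ S c = ∑[ x < n ] ⟦ (x ∈? S) ×-dec (ρ x ≟ᶠ c) ⟧

size : (Fin n → Fin k) → Fin k → ℕ
size {n} ρ c = ∑[ x < n ] ⟦ ρ x ≟ᶠ c ⟧

0C≡ : ∀ h → 0 C h ≡ ⟦ 0 ≟ h ⟧
0C≡ zero    = refl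
0C≡ (suc h) = k>n⇒nCk≡0 {0} {suc h} (s≤s z≤n)

δ : Fin k → Fin k → ℕ
δ q c = ⟦ q ≟ᶠ c ⟧

-- The only factor whose upper index changes is the one at `q`, and there the lower index is 0, so
-- it is 1 either way.
∏-pascal-zero : (q : Fin k) (s h : Fin k → ℕ) → h q ≡ 0 →
                ∏ (λ c → (δ q c + s c) C h c) ≡ ∏ (λ c → s c C h c)
∏-pascal-zero q s h hq≡0 = ∏-cong λ c → pointwise c (q ≟ᶠ c)
  where
  pointwise : ∀ c (q≟c : Dec (q ≡ c)) → (⟦ q≟c ⟧ + s c) C h c ≡ s c C h c
  pointwise c (yes refl) rewrite hq≡0 = refl
  pointwise c (no _)                  = refl

-- Pascal's rule in the one factor at `q`; distributivity carries the resulting sum through the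
-- other factors.
∏-pascal-suc : ∀ {m} (q : Fin k) (s h : Fin k → ℕ) → h q ≡ suc m →
               ∏ (λ c → (δ q c + s c) C h c) ≡
               ∏ (λ c → s c C h c) + ∏ (λ c → s c C (h c ∸ δ q c))
∏-pascal-suc {m = m} zero s h eq rewrite eq = trans
  (cong (_* rest) (trans (sym (nCk+nC[k+1]≡[n+1]C[k+1] (s zero) m)) (+-comm (s zero C m) (s zero C suc m))))
  (*-distribʳ-+ rest (s zero C suc m) (s zero C m))
  where
  rest = ∏ (λ c → s (suc c) C h (suc c))
∏-pascal-suc (suc q) s h eq = trans
  (cong ((s zero C h zero) *_) (∏-pascal-suc q (s ∘ suc) (h ∘ suc) eq))
  (*-distribˡ-+ (s zero C h zero) _ _)

-- The colour classes are filled independently, hence the product of binomials. The induction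
-- separates the subsets omitting the first element from those containing it, matching the two terms
-- of Pascal's rule for its colour.
∑ˢ-hits : (ρ : Fin n → Fin k) (h : Fin k → ℕ) →
          ∑ˢ n (λ S → ⟦ all? (λ c → hits ρ S c ≟ h c) ⟧) ≡ ∏ (λ c → size ρ c C h c)
∑ˢ-hits {zero} ρ h = trans (+-identityʳ _)
  (trans (⟦all⟧≡∏⟦⟧ (λ c → 0 ≟ h c)) (∏-cong λ c → sym (0C≡ (h c))))
∑ˢ-hits {suc n} {k} ρ h = trans (∑ˢ-suc {n} (λ S → ⟦ all? (λ c → hits ρ S c ≟ h c) ⟧)) (by-cases (h (ρ zero)) refl)
  where
  H : Subset n → Fin k → ℕ
  H = hits (ρ ∘ suc)

  withZero : Subset n → ℕ
  withZero S = ⟦ all? (λ c → δ (ρ zero) c + H S c ≟ h c) ⟧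

  by-cases : ∀ m → h (ρ zero) ≡ m →
             ∑ˢ n (λ S → ⟦ all? (λ c → H S c ≟ h c) ⟧) + ∑ˢ n withZero ≡
             ∏ (λ c → (δ (ρ zero) c + size (ρ ∘ suc) c) C h c)
  by-cases zero eq = trans
    (cong₂ _+_ (∑ˢ-hits (ρ ∘ suc) h)
      (trans (∑∈-cong (allSubsets n) λ S → ⟦⟧-false (all? _) (impossible S)) (∑∈-0 (allSubsets n))))
    (trans (+-identityʳ _) (sym (∏-pascal-zero (ρ zero) _ h eq)))
    where
    impossible : ∀ S → ¬ (∀ c → δ (ρ zero) c + H S c ≡ h c)
    impossible S all = contradiction
      (trans (sym (cong (_+ H S (ρ zero)) (⟦⟧-true (ρ zero ≟ᶠ ρ zero) refl))) (trans (all (ρ zero)) eq)) λ ()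
  -- Removing the first element from a set lowers the prescribed count of its colour by one. That
  -- count is positive here, so the truncated subtraction is exact.
  by-cases (suc m) eq = trans
    (cong₂ _+_ (∑ˢ-hits (ρ ∘ suc) h)
      (trans (∑∈-cong (allSubsets n) λ S → ⟦⟧-cong (all? _) (all? _)
               (λ all c → sym (trans (cong (_∸ δ (ρ zero) c) (sym (all c))) (m+n∸m≡n (δ (ρ zero) c) _)))
               (λ all c → trans (cong₂ _+_ {δ (ρ zero) c} refl (all c)) (m+[n∸m]≡n (δ≤h c))))
             (∑ˢ-hits (ρ ∘ suc) (λ c → h c ∸ δ (ρ zero) c))))
    (sym (∏-pascal-suc (ρ zero) _ h eq))
    where
    δ≤h : ∀ c → δ (ρ zero) c ≤ h c
    δ≤h c with ρ zero ≟ᶠ c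
    ... | yes refl rewrite eq = s≤s z≤n
    ... | no _ = z≤n

-- Sums over initial segments, and reading membership off colour counts.

sum-applyUpTo : ∀ (f : ℕ → ℕ) n → List.sum (applyUpTo f n) ≡ ∑[ x < n ] f (toℕ x)
sum-applyUpTo f zero    = refl
sum-applyUpTo f (suc n) = cong₂ _+_ refl (sum-applyUpTo (f ∘ suc) n)

∑₁≡∑ : ∀ n (f : ℕ → ℕ) → ∑₁ n f ≡ ∑[ x < n ] f (suc (toℕ x))
∑₁≡∑ n f = sum-applyUpTo (f ∘ suc) n

∑-≟-toℕ : ∀ y n → ∑[ x < n ] ⟦ y ≟ toℕ x ⟧ ≡ ⟦ y <? n ⟧
∑-≟-toℕ y n = sym (∑-unique (y <? n) (λ x → y ≟ toℕ x)
  (λ y<n → fromℕ< y<n , sym (toℕ-fromℕ< y<n)) (λ { {x} refl → toℕ<n x })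
  λ p q → toℕ-injective (trans (sym p) q))

∣∣≡∑ : (S : Subset n) → ∣ S ∣ ≡ ∑[ x < n ] ⟦ x ∈? S ⟧
∣∣≡∑ Vec.[]              = refl
∣∣≡∑ (outside Vec.∷ S) = ∣∣≡∑ S
∣∣≡∑ (inside  Vec.∷ S) = cong suc (∣∣≡∑ S)

∑-hits≡∣∣ : (ρ : Fin n → Fin k) (S : Subset n) → ∑[ c < k ] hits ρ S c ≡ ∣ S ∣
∑-hits≡∣∣ ρ S = trans (∑-comm (λ c x → ⟦ (x ∈? S) ×-dec (ρ x ≟ᶠ c) ⟧))
  (trans (sum-cong-≗ λ x → sym (∑-unique (x ∈? S) (λ c → (x ∈? S) ×-dec (ρ x ≟ᶠ c))
           (λ x∈S → ρ x , x∈S , refl) proj₁ (λ (_ , p) (_ , q) → trans (sym p) q)))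
         (sym (∣∣≡∑ S)))

module _ (ρ : Fin n → Fin k) (S : Subset n) (c : Fin k) where

  hits≡0⇒ : hits ρ S c ≡ 0 → ∀ {x} → x ∈ S → ρ x ≢ c
  hits≡0⇒ eq {x} x∈S ρx≡c = ⟦⟧≡0⇒ ((x ∈? S) ×-dec (ρ x ≟ᶠ c)) (∑≡0⇒ eq x) (x∈S , ρx≡c)

  ⇒hits≡0 : (∀ {x} → x ∈ S → ρ x ≢ c) → hits ρ S c ≡ 0
  ⇒hits≡0 f = ∑-zero λ x → ⟦⟧-false ((x ∈? S) ×-dec (ρ x ≟ᶠ c)) λ (x∈S , eq) → f x∈S eq

  hits>0⇒ : 1 ≤ hits ρ S c → ∃ λ x → x ∈ S × ρ x ≡ c
  hits>0⇒ pos with any? (λ x → (x ∈? S) ×-dec (ρ x ≟ᶠ c))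
  ... | yes w = w
  ... | no ¬w = contradiction (⇒hits≡0 λ x∈S eq → ¬w (_ , x∈S , eq)) (>⇒≢ pos)

  ⇒hits>0 : ∀ {x} → x ∈ S → ρ x ≡ c → 1 ≤ hits ρ S c
  ⇒hits>0 x∈S eq = n≢0⇒n>0 λ h≡0 → hits≡0⇒ h≡0 x∈S eq

  misses : ℕ
  misses = ∑[ x < n ] ⟦ ¬? (x ∈? S) ×-dec (ρ x ≟ᶠ c) ⟧

  size≡hits+misses : size ρ c ≡ hits ρ S c + misses
  size≡hits+misses = trans (sum-cong-≗ λ x → pointwise (x ∈? S) (ρ x ≟ᶠ c)) (∑-distrib-+ (λ x → ⟦ (x ∈? S) ×-dec (ρ x ≟ᶠ c) ⟧) _)
    where
    pointwise : (P? : Dec P) (Q? : Dec Q) → ⟦ Q? ⟧ ≡ ⟦ P? ×-dec Q? ⟧ + ⟦ ¬? P? ×-dec Q? ⟧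
    pointwise (yes _) Q? = sym (+-identityʳ ⟦ Q? ⟧)
    pointwise (no _)  Q? = refl

  hits≡size⇒ : hits ρ S c ≡ size ρ c → ∀ {x} → ρ x ≡ c → x ∈ S
  hits≡size⇒ eq {x} ρx≡c with x ∈? S
  ... | yes x∈S = x∈S
  ... | no  x∉S = contradiction (x∉S , ρx≡c) (⟦⟧≡0⇒ (¬? (x ∈? S) ×-dec (ρ x ≟ᶠ c)) (∑≡0⇒ misses≡0 x))
    where
    misses≡0 : misses ≡ 0
    misses≡0 = +-cancelˡ-≡ (hits ρ S c) misses 0 (trans (sym size≡hits+misses) (trans (sym eq) (sym (+-identityʳ _))))

  ⇒hits≡size : (∀ {x} → ρ x ≡ c → x ∈ S) → hits ρ S c ≡ size ρ c
  ⇒hits≡size f = sum-cong-≗ λ x → ⟦⟧-cong ((x ∈? S) ×-dec (ρ x ≟ᶠ c)) (ρ x ≟ᶠ c) proj₂ (λ eq → f eq , eq)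

-- Binomials with integer arguments.

sub-sub : ∀ i a f → + i - + a - + f ≡ i ⊖ (a + f)
sub-sub i a f = trans (ℤ.+-assoc (+ i) (ℤ.- + a) (ℤ.- + f))
  (trans (cong (λ z → + i ℤ.+ z) (sym (ℤ.neg-distrib-+ (+ a) (+ f)))) (ℤ.m-n≡m⊖n i (a + f)))

binom-⊖-≥ : ∀ m {i j} → j ≤ i → binom (+ m) (i ⊖ j) ≡ m C (i ∸ j)
binom-⊖-≥ m j≤i = cong (binom (+ m)) (ℤ.⊖-≥ j≤i)

binom-⊖-< : ∀ m {i j} → i < j → binom (+ m) (i ⊖ j) ≡ 0
binom-⊖-< m {i} {j} i<j = trans (cong (binom (+ m)) (ℤ.⊖-< i<j)) (neg (j ∸ i) (m<n⇒0<n∸m i<j))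
  where
  neg : ∀ t → 0 < t → binom (+ m) (ℤ.- + t) ≡ 0
  neg (suc t) _ = refl

-- Counting subsets under four kinds of constraint.

pattern absent = zero
pattern forced = suc zero
pattern chosen = suc (suc zero)
pattern free   = suc (suc (suc zero))

module _ (ρ : Fin n → Fin 4) where

  -- Equality of counts encodes that `S` contains the whole `forced` class. The condition on
  -- `chosen` is stated separately, because it is sometimes an exact count and sometimes positivity;
  -- `free` elements are arbitrary.
  Fits : Subset n → Set
  Fits S = hits ρ S absent ≡ 0 × hits ρ S forced ≡ size ρ forced

  fits? : ∀ S → Dec (Fits S)
  fits? S = (hits ρ S absent ≟ 0) ×-dec (hits ρ S forced ≟ size ρ forced)

  -- The cardinality `i` determines the number of `free` elements as what remains after the `chosen`
  -- and `forced` ones, so all four counts are prescribed and `∑ˢ-hits` applies. Its `absent` and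
  -- `forced` factors are 1.
  ∑ˢ-fits-exactly : ∀ a i → ∑ˢ n (λ S → ⟦ (fits? S ×-dec (hits ρ S chosen ≟ a)) ×-dec (∣ S ∣ ≟ i) ⟧) ≡
                    (size ρ chosen C a) * binom (+ size ρ free) (+ i - + a - + size ρ forced)
  ∑ˢ-fits-exactly a i rewrite sub-sub i a (size ρ forced) with (a + size ρ forced) ≤? i
  ... | yes a+f≤i = begin
    ∑ˢ n (λ S → ⟦ (fits? S ×-dec (hits ρ S chosen ≟ a)) ×-dec (∣ S ∣ ≟ i) ⟧)
      ≡⟨ ∑∈-cong (allSubsets n) (λ S → ⟦⟧-cong ((fits? S ×-dec (hits ρ S chosen ≟ a)) ×-dec (∣ S ∣ ≟ i)) (all? (λ c → hits ρ S c ≟ h c)) (to S) (from S)) ⟩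
    ∑ˢ n (λ S → ⟦ all? (λ c → hits ρ S c ≟ h c) ⟧)
      ≡⟨ ∑ˢ-hits ρ h ⟩
    1 * ((f C f) * ((s C a) * ((size ρ free C b) * 1)))
      ≡⟨ *-identityˡ _ ⟩
    (f C f) * ((s C a) * ((size ρ free C b) * 1))
      ≡⟨ cong₂ _*_ (nCn≡1 f) (cong ((s C a) *_) (*-identityʳ _)) ⟩
    1 * ((s C a) * (size ρ free C b))
      ≡⟨ *-identityˡ _ ⟩
    (s C a) * (size ρ free C b)
      ≡⟨ cong ((s C a) *_) (binom-⊖-≥ (size ρ free) a+f≤i) ⟨
    (s C a) * binom (+ size ρ free) (i ⊖ (a + f)) ∎
    where
    open ≡-Reasoning
    f = size ρ forced
    s = size ρ chosen
    b = i ∸ (a + f)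
    h : Fin 4 → ℕ
    h = Vec.lookup (0 Vec.∷ f Vec.∷ a Vec.∷ b Vec.∷ Vec.[])
    total : ∀ x → a + f + x ≡ 0 + (f + (a + (x + 0)))
    total x = trans (cong₂ _+_ (+-comm a f) (sym (+-identityʳ x))) (+-assoc f a (x + 0))
    to : ∀ S → (Fits S × hits ρ S chosen ≡ a) × ∣ S ∣ ≡ i → ∀ c → hits ρ S c ≡ h c
    to S (((e₀ , e₁) , e₂) , e) absent = e₀
    to S (((e₀ , e₁) , e₂) , e) forced = e₁
    to S (((e₀ , e₁) , e₂) , e) chosen = e₂
    to S (((e₀ , e₁) , e₂) , e) free   = sym (trans (cong (_∸ (a + f)) i≡) (m+n∸m≡n (a + f) (hits ρ S free)))
      where
      i≡ : i ≡ a + f + hits ρ S free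
      i≡ = trans (sym e) (trans (sym (∑-hits≡∣∣ ρ S)) (trans
        (cong₂ _+_ e₀ (cong₂ _+_ e₁ (cong₂ _+_ e₂ refl))) (sym (total (hits ρ S free)))))
    from : ∀ S → (∀ c → hits ρ S c ≡ h c) → (Fits S × hits ρ S chosen ≡ a) × ∣ S ∣ ≡ i
    from S e = ((e absent , e forced) , e chosen) ,
      trans (sym (∑-hits≡∣∣ ρ S)) (trans (sum-cong-≗ e) (trans (sym (total b)) (m+[n∸m]≡n a+f≤i)))
  -- Such a set would have at least `a + size ρ forced` elements, so there is none; on the right the
  -- lower index is negative and `binom` returns its default 0.
  ... | no a+f≰i = begin
    ∑ˢ n (λ S → ⟦ (fits? S ×-dec (hits ρ S chosen ≟ a)) ×-dec (∣ S ∣ ≟ i) ⟧)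
      ≡⟨ ∑∈-cong (allSubsets n) (λ S → ⟦⟧-false ((fits? S ×-dec (hits ρ S chosen ≟ a)) ×-dec (∣ S ∣ ≟ i)) (impossible S)) ⟩
    ∑ˢ n (λ S → 0)
      ≡⟨ ∑∈-0 (allSubsets n) ⟩
    0
      ≡⟨ *-zeroʳ (size ρ chosen C a) ⟨
    (size ρ chosen C a) * 0
      ≡⟨ cong ((size ρ chosen C a) *_) (binom-⊖-< (size ρ free) (≰⇒> a+f≰i)) ⟨
    (size ρ chosen C a) * binom (+ size ρ free) (i ⊖ (a + size ρ forced)) ∎
    where
    open ≡-Reasoning
    impossible : ∀ S → ¬ ((Fits S × hits ρ S chosen ≡ a) × ∣ S ∣ ≡ i)
    impossible S (((e₀ , e₁) , e₂) , e) = a+f≰i (subst₂ _≤_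
      (trans (cong₂ _+_ e₁ e₂) (+-comm (size ρ forced) a))
      (trans (∑-hits≡∣∣ ρ S) e)
      (≤-trans (+-monoʳ-≤ (hits ρ S forced) (m≤m+n (hits ρ S chosen) (hits ρ S free + 0))) (m≤n+m _ (hits ρ S absent))))

  -- Split by the exact number `a` of `chosen` elements. It is at least 1 and at most the
  -- cardinality `i`, so cutting the sum at `i` loses nothing.
  ∑ˢ-fits : ∀ i → ∑ˢ n (λ S → ⟦ (fits? S ×-dec (1 ≤? hits ρ S chosen)) ×-dec (∣ S ∣ ≟ i) ⟧) ≡
            ∑₁ i (λ a → (size ρ chosen C a) * binom (+ size ρ free) (+ i - + a - + size ρ forced))
  ∑ˢ-fits i = begin
    ∑ˢ n (λ S → ⟦ (fits? S ×-dec (1 ≤? hits ρ S chosen)) ×-dec (∣ S ∣ ≟ i) ⟧)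
      ≡⟨ ∑∈-cong (allSubsets n) (λ S → ∑-unique ((fits? S ×-dec (1 ≤? hits ρ S chosen)) ×-dec (∣ S ∣ ≟ i)) (W? S)
           (exists S) (λ { ((fits , e) , i≡) → (fits , subst (1 ≤_) (sym e) (s≤s z≤n)) , i≡ })
           λ { ((_ , p) , _) ((_ , q) , _) → toℕ-injective (suc-injective (trans (sym p) q)) }) ⟩
    ∑ˢ n (λ S → ∑[ x < i ] ⟦ W? S x ⟧)
      ≡⟨ ∑∈-∑-comm (allSubsets n) (λ x S → ⟦ W? S x ⟧) ⟩
    ∑[ x < i ] ∑ˢ n (λ S → ⟦ W? S x ⟧)
      ≡⟨ sum-cong-≗ {i} (λ x → ∑ˢ-fits-exactly (suc (toℕ x)) i) ⟩
    ∑[ x < i ] summand (suc (toℕ x))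
      ≡⟨ ∑₁≡∑ i summand ⟨
    ∑₁ i summand ∎
    where
    open ≡-Reasoning
    summand : ℕ → ℕ
    summand a = (size ρ chosen C a) * binom (+ size ρ free) (+ i - + a - + size ρ forced)
    W : Subset n → Fin i → Set
    W S x = (Fits S × hits ρ S chosen ≡ suc (toℕ x)) × ∣ S ∣ ≡ i
    W? : ∀ S x → Dec (W S x)
    W? S x = (fits? S ×-dec (hits ρ S chosen ≟ suc (toℕ x))) ×-dec (∣ S ∣ ≟ i)
    chosen≤ : ∀ S → hits ρ S chosen ≤ ∣ S ∣
    chosen≤ S = subst (hits ρ S chosen ≤_) (∑-hits≡∣∣ ρ S)
      (≤-trans (m≤m+n _ _) (≤-trans (m≤n+m _ (hits ρ S forced)) (m≤n+m _ (hits ρ S absent))))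
    exists : ∀ S → (Fits S × 1 ≤ hits ρ S chosen) × ∣ S ∣ ≡ i → ∃ (W S)
    exists S ((fits , pos) , refl) with hits ρ S chosen | chosen≤ S
    exists S ((fits , s≤s z≤n) , refl) | suc m | m<i = fromℕ< m<i , (fits , cong suc (sym (toℕ-fromℕ< m<i))) , refl

-- Graphs whose adjacency is a threshold condition on levels

-- Used where no `free` element exists: the cardinality is then determined, and the binomial
-- degenerates to an indicator.
binom-0-⊖ : ∀ i j → binom (+ 0) (i ⊖ j) ≡ ⟦ i ≟ j ⟧
binom-0-⊖ i j with j ≤? i
... | yes j≤i = trans (binom-⊖-≥ 0 j≤i) (trans (0C≡ (i ∸ j))
  (⟦⟧-cong (0 ≟ i ∸ j) (i ≟ j) (λ eq → ≤-antisym (m∸n≡0⇒m≤n (sym eq)) j≤i) (λ eq → sym (m≤n⇒m∸n≡0 (≤-reflexive eq)))))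
... | no j≰i = trans (binom-⊖-< 0 (≰⇒> j≰i)) (sym (⟦⟧-false (i ≟ j) (j≰i ∘ ≤-reflexive ∘ sym)))

∑₁-suc : ∀ n (f : ℕ → ℕ) → ∑₁ (suc n) f ≡ ∑₁ n f + f (suc n)
∑₁-suc zero    f = +-identityʳ (f 1)
∑₁-suc (suc n) f = trans (cong₂ _+_ {f 1} refl (∑₁-suc n (f ∘ suc))) (sym (+-assoc (f 1) (∑₁ n (f ∘ suc)) (f (suc (suc n)))))

∑₁-cong : ∀ n {f g : ℕ → ℕ} → (∀ {k} → 1 ≤ k → k ≤ n → f k ≡ g k) → ∑₁ n f ≡ ∑₁ n g
∑₁-cong zero    eq = refl
∑₁-cong (suc n) eq = cong₂ _+_ (eq (s≤s z≤n) (s≤s z≤n)) (∑₁-cong n λ 1≤k k≤n → eq (m≤n⇒m≤1+n 1≤k) (s≤s k≤n))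

-- The arithmetic of the ring enters the count only through these four properties of `ℓ`. Ambient
-- elements outside `V` have level 0 or level at least `α`.
module Threshold
  (G : SimpleGraph) (α : ℕ) (ℓ : Fin (SimpleGraph.size G) → ℕ)
  (∈V⇒ : ∀ {x : Fin (SimpleGraph.size G)} → x ∈ SimpleGraph.V G → 1 ≤ ℓ x × ℓ x < α)
  (⇒∈V : ∀ {x : Fin (SimpleGraph.size G)} → 1 ≤ ℓ x → ℓ x < α → x ∈ SimpleGraph.V G)
  (~⇒ : ∀ {u v : Fin (SimpleGraph.size G)} → SimpleGraph._~_ G u v → α ≤ ℓ u + ℓ v)
  (⇒~ : ∀ {u v : Fin (SimpleGraph.size G)} → u ≢ v → α ≤ ℓ u + ℓ v → SimpleGraph._~_ G u v)
  where

  open SimpleGraph G using (V; _~_) renaming (size to N)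

  level : ℕ → ℕ
  level k = ∑[ x < N ] ⟦ ℓ x ≟ k ⟧

  -- The second condition says that `S` misses the levels from α - r upwards; the additive form
  -- avoids truncated subtraction.
  DominatingBelow : ℕ → Subset N → Set
  DominatingBelow r S = IsDominating G S × (∀ x → x ∈ S → ℓ x + r < α)

  dominatingBelow? : ∀ r S → Dec (DominatingBelow r S)
  dominatingBelow? r S = isDominating? G S ×-dec all? (λ x → (x ∈? S) →-dec (ℓ x + r <? α))

  -- The index is shifted by one: together with `DominatingBelow r`, this says that the least index
  -- at which `S` meets a level is r + 1.
  Meets : ℕ → Subset N → Set
  Meets r S = ∃ λ x → x ∈ S × ℓ x + suc r ≡ α

  meets? : ∀ r S → Dec (Meets r S)
  meets? r S = any? (λ x → (x ∈? S) ×-dec (ℓ x + suc r ≟ α))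

  #below : ℕ → ℕ → ℕ
  #below r i = ∑ˢ N (λ S → ⟦ dominatingBelow? r S ×-dec (∣ S ∣ ≟ i) ⟧)

  #meeting : ℕ → ℕ → ℕ
  #meeting r i = ∑ˢ N (λ S → ⟦ (dominatingBelow? r S ×-dec meets? r S) ×-dec (∣ S ∣ ≟ i) ⟧)

  d≡#below : ∀ i → d G i ≡ #below 0 i
  d≡#below i = trans (length-filter (λ S → isDominating? G S ×-dec (∣ S ∣ ≟ i)) (allSubsets N))
    (∑∈-cong (allSubsets N) λ S → ⟦⟧-cong (isDominating? G S ×-dec (∣ S ∣ ≟ i)) (dominatingBelow? 0 S ×-dec (∣ S ∣ ≟ i))
      (λ (dom , eq) → (dom , λ x x∈S → subst (_< α) (sym (+-identityʳ (ℓ x))) (proj₂ (∈V⇒ (proj₁ dom x∈S)))) , eq)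
      λ ((dom , _) , eq) → dom , eq)

  -- A set missing the levels from α - r upwards either meets the next level down, α - r - 1, or
  -- misses that one too.
  #below-step : ∀ r i → #below r i ≡ #meeting r i + #below (suc r) i
  #below-step r i = trans (∑∈-cong (allSubsets N) λ S →
      ⟦⟧-split (dominatingBelow? r S ×-dec (∣ S ∣ ≟ i)) ((dominatingBelow? r S ×-dec meets? r S) ×-dec (∣ S ∣ ≟ i))
        (dominatingBelow? (suc r) S ×-dec (∣ S ∣ ≟ i))
        (λ ((dom , below) , eq) → split dom below eq (meets? r S))
        (λ ((dom , _) , eq) → dom , eq)
        (λ ((dom , below) , eq) → (dom , λ x x∈S → <-trans (+-monoʳ-< (ℓ x) (n<1+n r)) (below x x∈S)) , eq)
        λ { (((_ , x , x∈S , eq) , _) , ((_ , below) , _)) → <⇒≢ (below x x∈S) eq })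
    (∑∈-+ (allSubsets N) _ _)
    where
    split : ∀ {S} → IsDominating G S → (∀ x → x ∈ S → ℓ x + r < α) → ∣ S ∣ ≡ i → Dec (Meets r S) →
            ((DominatingBelow r S × Meets r S) × ∣ S ∣ ≡ i) ⊎ (DominatingBelow (suc r) S × ∣ S ∣ ≡ i)
    split dom below eq (yes m) = inj₁ (((dom , below) , m) , eq)
    split dom below eq (no ¬m) = inj₂ ((dom , λ x x∈S →
      ≤∧≢⇒< (subst (_≤ α) (sym (+-suc (ℓ x) r)) (below x x∈S)) (λ eq → ¬m (x , x∈S , eq))) , eq)

  -- What `DominatingBelow r` together with `Meets r` demands of an element of level `y`. The index
  -- is the colour, so matching on a role recovers its defining inequalities. `absent` covers both
  -- the non-vertices and the vertices of level at least α - r.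
  data Role (r y : ℕ) : Fin 4 → Set where
    is-absent : ¬ (1 ≤ y × y + r < α) → Role r y absent
    is-forced : 1 ≤ y → y ≤ r → y + r < α → Role r y forced
    is-chosen : r < y → y + suc r ≡ α → Role r y chosen
    is-free   : r < y → y + suc r < α → Role r y free

  role : ∀ r y → ∃ (Role r y)
  role r y with (1 ≤? y) ×-dec (y + r <? α)
  ... | no ¬p = absent , is-absent ¬p
  ... | yes (1≤y , y+r<α) with y ≤? r
  ...   | yes y≤r = forced , is-forced 1≤y y≤r y+r<α
  ...   | no y≰r with y + suc r ≟ α
  ...     | yes eq = chosen , is-chosen (≰⇒> y≰r) eq
  ...     | no neq = free , is-free (≰⇒> y≰r) (≤∧≢⇒< (subst (_≤ α) (sym (+-suc y r)) y+r<α) neq)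

  module _ (r : ℕ) where

    ρ : Fin N → Fin 4
    ρ x = proj₁ (role r (ℓ x))

    ρ-spec : ∀ x → Role r (ℓ x) (ρ x)
    ρ-spec x = proj₂ (role r (ℓ x))

    ρ-spec-≡ : ∀ {x c} → ρ x ≡ c → Role r (ℓ x) c
    ρ-spec-≡ {x} eq = subst (Role r (ℓ x)) eq (ρ-spec x)

    present⇒ : ∀ {x} → ρ x ≢ absent → 1 ≤ ℓ x × ℓ x + r < α
    present⇒ {x} ≢absent with ρ x | ρ-spec x
    ... | _ | is-absent _ = contradiction refl ≢absent
    ... | _ | is-forced 1≤y _ y+r<α = 1≤y , y+r<α
    ... | _ | is-chosen r<y eq = ≤-trans (s≤s z≤n) r<y , ≤-reflexive (trans (sym (+-suc (ℓ x) r)) eq)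
    ... | _ | is-free r<y lt = ≤-trans (s≤s z≤n) r<y , ≤-trans (≤-reflexive (sym (+-suc (ℓ x) r))) (<⇒≤ lt)

    absent⇒ : ∀ {x} → ρ x ≡ absent → ¬ (1 ≤ ℓ x × ℓ x + r < α)
    absent⇒ eq with ρ-spec-≡ eq
    ... | is-absent ¬p = ¬p

    forced⇒ : ∀ {x} → ρ x ≡ forced → 1 ≤ ℓ x × ℓ x ≤ r
    forced⇒ eq with ρ-spec-≡ eq
    ... | is-forced 1≤y y≤r _ = 1≤y , y≤r

    chosen⇒ : ∀ {x} → ρ x ≡ chosen → ℓ x + suc r ≡ α
    chosen⇒ eq with ρ-spec-≡ eq
    ... | is-chosen _ eq = eq

    -- The bound on `r` keeps the levels up to `r` below α - r, where they cannot be `absent`.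
    ⇒forced : r + r < α → ∀ {x} → 1 ≤ ℓ x → ℓ x ≤ r → ρ x ≡ forced
    ⇒forced 2r<α {x} 1≤y y≤r with ρ x | ρ-spec x
    ... | _ | is-absent ¬p = contradiction (1≤y , ≤-<-trans (+-monoˡ-≤ r y≤r) 2r<α) ¬p
    ... | _ | is-forced _ _ _ = refl
    ... | _ | is-chosen r<y _ = contradiction y≤r (<⇒≱ r<y)
    ... | _ | is-free r<y _ = contradiction y≤r (<⇒≱ r<y)

    -- The bound puts level α - r - 1 strictly above `r`, so it does not fall among the `forced`
    -- levels.
    ⇒chosen : suc r + suc r ≤ α → ∀ {x} → ℓ x + suc r ≡ α → ρ x ≡ chosen
    ⇒chosen 2+2r≤α {x} eq = by-role (ρ-spec x)
      where
      r<ℓx : r < ℓ x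
      r<ℓx = +-cancelʳ-≤ (suc r) (suc r) (ℓ x) (subst (suc r + suc r ≤_) (sym eq) 2+2r≤α)
      by-role : ∀ {c} → Role r (ℓ x) c → c ≡ chosen
      by-role (is-absent ¬p) = contradiction (≤-trans (s≤s z≤n) r<ℓx , ≤-reflexive (trans (sym (+-suc (ℓ x) r)) eq)) ¬p
      by-role (is-forced _ y≤r _) = contradiction y≤r (<⇒≱ r<ℓx)
      by-role (is-chosen _ _) = refl
      by-role (is-free _ lt) = contradiction eq (<⇒≢ lt)

    -- A vertex of level at most `r` outside `S` would need a neighbour in `S` of level at least α -
    -- r, and `S` has none.
    dominatingBelow⇒fits : ∀ {S} → DominatingBelow r S → Fits ρ S
    dominatingBelow⇒fits {S} ((S⊆V , dom) , below) =
      ⇒hits≡0 ρ S absent (λ {x} x∈S eq → absent⇒ eq (proj₁ (∈V⇒ (S⊆V x∈S)) , below x x∈S)) ,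
      ⇒hits≡size ρ S forced in-S
      where
      in-S : ∀ {x} → ρ x ≡ forced → x ∈ S
      in-S {x} eq with x ∈? S | forced⇒ eq | ρ-spec-≡ eq
      ... | yes x∈S | _ | _ = x∈S
      ... | no x∉S | 1≤y , y≤r | is-forced _ _ y+r<α with dom x (⇒∈V 1≤y (≤-<-trans (m≤m+n (ℓ x) r) y+r<α)) x∉S
      ...   | u , u∈S , x~u = contradiction (below u u∈S)
        (≤⇒≯ (≤-trans (~⇒ x~u) (≤-trans (+-monoˡ-≤ (ℓ u) y≤r) (≤-reflexive (+-comm r (ℓ u))))))

    -- Vertices of level at most `r` are `forced` into `S`, and `u` is adjacent to every other
    -- vertex of level above `r`. The witness is kept general: it is a `chosen` element when a level
    -- is met, but a `forced` one in the remaining odd case.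
    fits⇒dominatingBelow : r + r < α → ∀ {S} → Fits ρ S →
      (∃ λ u → u ∈ S × α ≤ suc r + ℓ u) → DominatingBelow r S
    fits⇒dominatingBelow 2r<α {S} (no-absent , all-forced) (u , u∈S , α≤) = (S⊆V , dom) , λ x x∈S → proj₂ (present x∈S)
      where
      present : ∀ {x} → x ∈ S → 1 ≤ ℓ x × ℓ x + r < α
      present x∈S = present⇒ (hits≡0⇒ ρ S absent no-absent x∈S)
      S⊆V : ∀ {x} → x ∈ S → x ∈ V
      S⊆V {x} x∈S with present x∈S
      ... | 1≤y , y+r<α = ⇒∈V 1≤y (≤-<-trans (m≤m+n (ℓ x) r) y+r<α)
      dom : ∀ v → v ∈ V → v ∉ S → ∃ λ u → u ∈ S × v ~ u
      dom v v∈V v∉S = u , u∈S , ⇒~ (λ { refl → v∉S u∈S }) (≤-trans α≤ (+-monoˡ-≤ (ℓ u) (≰⇒> λ ℓv≤r →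
        v∉S (hits≡size⇒ ρ S forced all-forced (⇒forced 2r<α (proj₁ (∈V⇒ v∈V)) ℓv≤r)))))

    size-forced : r + r < α → size ρ forced ≡ ∑₁ r level
    size-forced 2r<α = begin
      ∑[ x < N ] ⟦ ρ x ≟ᶠ forced ⟧
        ≡⟨ sum-cong-≗ (λ x → ∑-unique (ρ x ≟ᶠ forced) (λ k → ℓ x ≟ suc (toℕ k)) (exists x) (level⇒forced x)
             λ p q → toℕ-injective (suc-injective (trans (sym p) q))) ⟩
      ∑[ x < N ] ∑[ k < r ] ⟦ ℓ x ≟ suc (toℕ k) ⟧
        ≡⟨ ∑-comm {N} {r} (λ x k → ⟦ ℓ x ≟ suc (toℕ k) ⟧) ⟩
      ∑[ k < r ] level (suc (toℕ k))
        ≡⟨ ∑₁≡∑ r level ⟨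
      ∑₁ r level ∎
      where
      open ≡-Reasoning
      exists : ∀ x → ρ x ≡ forced → ∃ λ (k : Fin r) → ℓ x ≡ suc (toℕ k)
      exists x eq with ℓ x | forced⇒ eq
      ... | suc y | _ , y<r = fromℕ< y<r , cong suc (sym (toℕ-fromℕ< y<r))
      level⇒forced : ∀ x {k : Fin r} → ℓ x ≡ suc (toℕ k) → ρ x ≡ forced
      level⇒forced x {k} eq = ⇒forced 2r<α (subst (1 ≤_) (sym eq) (s≤s z≤n)) (subst (_≤ r) (sym eq) (toℕ<n k))

    size-chosen : suc r + suc r ≤ α → size ρ chosen ≡ level (α ∸ suc r)
    size-chosen 2+2r≤α = sum-cong-≗ λ x → ⟦⟧-cong (ρ x ≟ᶠ chosen) (ℓ x ≟ α ∸ suc r)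
      (λ eq → trans (sym (m+n∸n≡m (ℓ x) (suc r))) (cong (_∸ suc r) (chosen⇒ eq)))
      (λ eq → ⇒chosen 2+2r≤α (trans (cong (_+ suc r) eq) (m∸n+n≡m (≤-trans (m≤m+n (suc r) (suc r)) 2+2r≤α))))

    -- Solved for `size ρ free`, this yields the upper argument of the second binomial. The vertices
    -- coloured `absent` are those of level at least α - r, singled out by `High?` and counted as
    -- the levels α - 1, ..., α - r by `high`.
    order-decomposition : r + r < α →
      order G ≡ size ρ free + (size ρ chosen + ∑₁ r (λ k → level (α ∸ k) + level k))
    order-decomposition 2r<α = begin
      ∣ V ∣
        ≡⟨ ∣∣≡∑ V ⟩
      ∑[ x < N ] ⟦ x ∈? V ⟧
        ≡⟨ sum-cong-≗ pointwise ⟩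
      ∑[ x < N ] (⟦ ρ x ≟ᶠ free ⟧ + (⟦ ρ x ≟ᶠ chosen ⟧ + (high x + ⟦ ρ x ≟ᶠ forced ⟧)))
        ≡⟨ ∑-distrib-+ (λ x → ⟦ ρ x ≟ᶠ free ⟧) _ ⟩
      size ρ free + ∑[ x < N ] (⟦ ρ x ≟ᶠ chosen ⟧ + (high x + ⟦ ρ x ≟ᶠ forced ⟧))
        ≡⟨ cong₂ _+_ refl (∑-distrib-+ (λ x → ⟦ ρ x ≟ᶠ chosen ⟧) _) ⟩
      size ρ free + (size ρ chosen + ∑[ x < N ] (high x + ⟦ ρ x ≟ᶠ forced ⟧))
        ≡⟨ cong (λ t → size ρ free + (size ρ chosen + t)) (trans (∑-distrib-+ high _)
             (cong₂ _+_ (∑-comm {N} {r} (λ x k → ⟦ ℓ x ≟ α ∸ suc (toℕ k) ⟧)) (trans (size-forced 2r<α) (∑₁≡∑ r level)))) ⟩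
      size ρ free + (size ρ chosen + (∑[ k < r ] level (α ∸ suc (toℕ k)) + ∑[ k < r ] level (suc (toℕ k))))
        ≡⟨ cong (λ t → size ρ free + (size ρ chosen + t))
             (trans (∑₁≡∑ r (λ k → level (α ∸ k) + level k)) (∑-distrib-+ {r} (λ k → level (α ∸ suc (toℕ k))) _)) ⟨
      size ρ free + (size ρ chosen + ∑₁ r (λ k → level (α ∸ k) + level k)) ∎
      where
      open ≡-Reasoning
      high : Fin N → ℕ
      high x = ∑[ k < r ] ⟦ ℓ x ≟ α ∸ suc (toℕ k) ⟧
      High? : ∀ x → Dec (α ≤ ℓ x + r × ℓ x < α)
      High? x = (α ≤? ℓ x + r) ×-dec (ℓ x <? α)
      r≤α : r ≤ α
      r≤α = ≤-trans (m≤m+n r r) (<⇒≤ 2r<α)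
      high≡ : ∀ x → high x ≡ ⟦ High? x ⟧
      high≡ x = sym (∑-unique (High? x) (λ k → ℓ x ≟ α ∸ suc (toℕ k)) exists out
        λ {j} {k} p q → toℕ-injective (suc-injective (∸-cancelˡ-≡ (≤-trans (toℕ<n j) r≤α) (≤-trans (toℕ<n k) r≤α) (trans (sym p) q))))
        where
        exists : α ≤ ℓ x + r × ℓ x < α → ∃ λ (k : Fin r) → ℓ x ≡ α ∸ suc (toℕ k)
        exists (α≤ , ℓ<α) = fromℕ< t<r , sym (trans (cong (λ t → α ∸ suc t) (toℕ-fromℕ< t<r))
            (trans (cong (α ∸_) (sym (+-∸-assoc 1 ℓ<α))) (m∸[m∸n]≡n (<⇒≤ ℓ<α))))
          where
          t<r : α ∸ suc (ℓ x) < r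
          t<r = subst (_≤ r) (+-∸-assoc 1 ℓ<α) (m≤n+o⇒m∸n≤o α (ℓ x) α≤)
        out : ∀ {k : Fin r} → ℓ x ≡ α ∸ suc (toℕ k) → α ≤ ℓ x + r × ℓ x < α
        out {k} eq = subst (λ t → α ≤ t + r) (sym eq) (≤-trans (≤-reflexive (sym (m∸n+n≡m k<α))) (+-monoʳ-≤ _ (toℕ<n k))) ,
                     subst (_< α) (sym eq) (∸-monoʳ-< (s≤s z≤n) k<α)
          where
          k<α : suc (toℕ k) ≤ α
          k<α = ≤-trans (toℕ<n k) r≤α
      by-role : ∀ {c} x → Role r (ℓ x) c →
        ⟦ x ∈? V ⟧ ≡ ⟦ c ≟ᶠ free ⟧ + (⟦ c ≟ᶠ chosen ⟧ + (⟦ High? x ⟧ + ⟦ c ≟ᶠ forced ⟧))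
      by-role x (is-absent ¬p) = trans
        (⟦⟧-cong (x ∈? V) (High? x)
          (λ x∈V → ≮⇒≥ (λ lt → ¬p (proj₁ (∈V⇒ x∈V) , lt)) , proj₂ (∈V⇒ x∈V))
          (λ (α≤ , ℓ<α) → ⇒∈V (n≢0⇒n>0 λ ℓ≡0 → <⇒≱ (≤-<-trans (m≤m+n r r) 2r<α) (subst (λ t → α ≤ t + r) ℓ≡0 α≤)) ℓ<α))
        (sym (+-identityʳ _))
      by-role x (is-forced 1≤y y≤r lt) = trans (⟦⟧-true (x ∈? V) (⇒∈V 1≤y (≤-<-trans (m≤m+n (ℓ x) r) lt)))
        (sym (cong (_+ 1) (⟦⟧-false (High? x) λ (α≤ , _) → <⇒≱ lt α≤)))
      by-role x (is-chosen r<y eq) = trans (⟦⟧-true (x ∈? V) (⇒∈V (≤-trans (s≤s z≤n) r<y) (≤-<-trans (m≤m+n (ℓ x) r) lt)))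
        (sym (cong (λ t → suc (t + 0)) (⟦⟧-false (High? x) λ (α≤ , _) → <⇒≱ lt α≤)))
        where
        lt : ℓ x + r < α
        lt = ≤-reflexive (trans (sym (+-suc (ℓ x) r)) eq)
      by-role x (is-free r<y eq) = trans (⟦⟧-true (x ∈? V) (⇒∈V (≤-trans (s≤s z≤n) r<y) (≤-<-trans (m≤m+n (ℓ x) r) lt)))
        (sym (cong (λ t → suc (t + 0)) (⟦⟧-false (High? x) λ (α≤ , _) → <⇒≱ lt α≤)))
        where
        lt : ℓ x + r < α
        lt = ≤-trans (≤-reflexive (sym (+-suc (ℓ x) r))) (<⇒≤ eq)
      pointwise : ∀ x → ⟦ x ∈? V ⟧ ≡ ⟦ ρ x ≟ᶠ free ⟧ + (⟦ ρ x ≟ᶠ chosen ⟧ + (high x + ⟦ ρ x ≟ᶠ forced ⟧))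
      pointwise x = trans (by-role x (ρ-spec x))
        (cong (λ t → ⟦ ρ x ≟ᶠ free ⟧ + (⟦ ρ x ≟ᶠ chosen ⟧ + (t + ⟦ ρ x ≟ᶠ forced ⟧))) (sym (high≡ x)))

    module _ (2+2r≤α : suc r + suc r ≤ α) where

      2r<α : r + r < α
      2r<α = ≤-trans (s≤s (+-monoʳ-≤ r (n≤1+n r))) 2+2r≤α

      #meeting≡ : ∀ i → #meeting r i ≡
        ∑₁ i (λ a → (size ρ chosen C a) * binom (+ size ρ free) (+ i - + a - + size ρ forced))
      #meeting≡ i = trans (∑∈-cong (allSubsets N) λ S → ⟦⟧-cong
          ((dominatingBelow? r S ×-dec meets? r S) ×-dec (∣ S ∣ ≟ i))
          ((fits? ρ S ×-dec (1 ≤? hits ρ S chosen)) ×-dec (∣ S ∣ ≟ i))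
          (λ { ((dom , x , x∈S , eq) , eq′) → (dominatingBelow⇒fits dom , ⇒hits>0 ρ S chosen x∈S (⇒chosen 2+2r≤α eq)) , eq′ })
          (λ ((fits , pos) , eq) → from S fits (hits>0⇒ ρ S chosen pos) , eq))
        (∑ˢ-fits ρ i)
        where
        from : ∀ S → Fits ρ S → (∃ λ x → x ∈ S × ρ x ≡ chosen) → DominatingBelow r S × Meets r S
        from S fits (x , x∈S , eq) =
          fits⇒dominatingBelow 2r<α fits (x , x∈S , ≤-reflexive (trans (sym (chosen⇒ eq)) (+-comm (ℓ x) (suc r)))) ,
          x , x∈S , chosen⇒ eq

  -- The summand of the theorem for a fixed `r`, before evaluating level sizes: `level (α ∸ r)`
  -- stands for φ(p^r) and `level k` for φ(p^(α-k)).
  A : ℕ → ℕ → ℕ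
  A i r = ∑₁ i (λ a →
    binom (+ level (α ∸ r)) (+ a) *
    binom (+ order G - + level (α ∸ r) - + ∑₁ (r ∸ 1) (λ k → level (α ∸ k) + level k))
          (+ i - + a - + ∑₁ (r ∸ 1) level))

  #meeting≡A : ∀ r → suc r + suc r ≤ α → ∀ i → #meeting r i ≡ A i (suc r)
  #meeting≡A r 2+2r≤α i = trans (#meeting≡ r 2+2r≤α i) (∑₁-cong i λ {a} _ _ → cong₂ _*_
    (cong (_C a) (size-chosen r 2+2r≤α))
    (cong₂ (λ m f → binom m (+ i - + a - + f)) (sym free≡) (size-forced r (2r<α r 2+2r≤α))))
    where
    s = ∑₁ r (λ k → level (α ∸ k) + level k)
    c = level (α ∸ suc r)
    free≡ : + order G - + c - + s ≡ + size (ρ r) free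
    free≡ = trans (sub-sub (order G) c s) (trans
      (cong (_⊖ (c + s)) (trans (order-decomposition r (2r<α r 2+2r≤α)) (cong (λ t → size (ρ r) free + (t + s)) (size-chosen r 2+2r≤α))))
      (trans (ℤ.⊖-≥ (m≤n+m (c + s) (size (ρ r) free))) (cong +_ (m+n∸n≡m (size (ρ r) free) (c + s)))))

  -- Iterates `#below-step` from `r = 0`, where missing the levels from α upwards is automatic. The
  -- bound on `R` keeps every `chosen` level above the `forced` ones.
  d≡∑A+#below : ∀ R → R + R ≤ α → ∀ i → d G i ≡ ∑₁ R (A i) + #below R i
  d≡∑A+#below zero    _ i = d≡#below i
  d≡∑A+#below (suc R) h i = begin
    d G i                                     ≡⟨ d≡∑A+#below R (≤-trans (+-mono-≤ (n≤1+n R) (n≤1+n R)) h) i ⟩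
    ∑₁ R (A i) + #below R i                   ≡⟨ cong₂ _+_ refl (trans (#below-step R i) (cong (_+ #below (suc R) i) (#meeting≡A R h i))) ⟩
    ∑₁ R (A i) + (A i (suc R) + #below (suc R) i) ≡⟨ +-assoc (∑₁ R (A i)) _ _ ⟨
    ∑₁ R (A i) + A i (suc R) + #below (suc R) i   ≡⟨ cong (_+ #below (suc R) i) (∑₁-suc R (A i)) ⟨
    ∑₁ (suc R) (A i) + #below (suc R) i       ∎
    where open ≡-Reasoning

  -- After `R` steps no level lies strictly between R and α - R = R + 1, so nothing is `chosen` or
  -- `free`. The only remaining set is the union of the levels 1, ..., R, which accounts for the
  -- extra 1 at its cardinality.
  d-odd : ∀ R → 1 ≤ R → α ≡ suc (R + R) → (∃ λ x → ℓ x ≡ R) → ∀ i →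
          d G i ≡ ∑₁ R (A i) + ⟦ i ≟ ∑₁ R level ⟧
  d-odd R 1≤R α≡ (w , ℓw≡R) i = trans (d≡∑A+#below R (<⇒≤ 2R<α) i) (cong₂ _+_ refl (begin
    #below R i
      ≡⟨ ∑∈-cong (allSubsets N) (λ S → ⟦⟧-cong (dominatingBelow? R S ×-dec (∣ S ∣ ≟ i))
           ((fits? (ρ R) S ×-dec (hits (ρ R) S chosen ≟ 0)) ×-dec (∣ S ∣ ≟ i))
           (λ (dom , eq) → (dominatingBelow⇒fits R dom , ⇒hits≡0 (ρ R) S chosen (λ _ → none-chosen)) , eq)
           -- Since R + 1 + R = α, the `forced` element `w` of level `R` is enough to dominate
           -- everything above level `R`.
           (λ ((fits , _) , eq) → fits⇒dominatingBelow R 2R<α fits (w , w∈ S fits , ≤-reflexive (trans α≡ (cong suc (cong₂ _+_ refl (sym ℓw≡R))))) , eq)) ⟩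
    ∑ˢ N (λ S → ⟦ (fits? (ρ R) S ×-dec (hits (ρ R) S chosen ≟ 0)) ×-dec (∣ S ∣ ≟ i) ⟧)
      ≡⟨ ∑ˢ-fits-exactly (ρ R) 0 i ⟩
    1 * binom (+ size (ρ R) free) (+ i - + 0 - + size (ρ R) forced)
      ≡⟨ *-identityˡ _ ⟩
    binom (+ size (ρ R) free) (+ i - + 0 - + size (ρ R) forced)
      ≡⟨ cong₂ (λ m f → binom (+ m) f) (∑-zero λ x → ⟦⟧-false (ρ R x ≟ᶠ free) none-free)
           (trans (sub-sub i 0 (size (ρ R) forced)) (cong (i ⊖_) (size-forced R 2R<α))) ⟩
    binom (+ 0) (i ⊖ ∑₁ R level)
      ≡⟨ binom-0-⊖ i (∑₁ R level) ⟩
    ⟦ i ≟ ∑₁ R level ⟧ ∎))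
    where
    open ≡-Reasoning
    2R<α : R + R < α
    2R<α = ≤-reflexive (sym α≡)
    too-large : ∀ {y} → R < y → ¬ (y + suc R ≤ α)
    too-large R<y y+1+R≤α = 1+n≰n (≤-trans (s≤s (≤-reflexive (sym (+-suc R R)))) (≤-trans (+-monoˡ-≤ (suc R) R<y) (subst (_ ≤_) α≡ y+1+R≤α)))
    none-chosen : ∀ {x} → ρ R x ≢ chosen
    none-chosen eq with ρ-spec-≡ R eq
    ... | is-chosen R<y eq′ = too-large R<y (≤-reflexive eq′)
    none-free : ∀ {x} → ρ R x ≢ free
    none-free eq with ρ-spec-≡ R eq
    ... | is-free R<y lt = too-large R<y (<⇒≤ lt)
    w∈ : ∀ S → Fits (ρ R) S → w ∈ S
    w∈ S (_ , all-forced) = hits≡size⇒ (ρ R) S forced all-forced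
      (⇒forced R 2R<α (subst (1 ≤_) (sym ℓw≡R) 1≤R) (≤-reflexive ℓw≡R))

  -- Here the last step is the middle level R + 1 = α/2, both chosen from and directly above the
  -- `forced` levels. No `free` element is left, so `a` is tied to `i`; this gives the sum `B`.
  d-even : ∀ R → α ≡ suc R + suc R → (∃ λ x → ℓ x ≡ suc R) → ∀ i →
           d G i ≡ ∑₁ R (A i) + ∑₁ i (λ a → when (i ≟ a + ∑₁ R level) (binom (+ level (α ∸ suc R)) (+ a)))
  d-even R α≡ (w , ℓw≡) i = trans (d≡∑A+#below R (<⇒≤ 2R<α) i) (cong₂ _+_ refl (begin
    #below R i
      ≡⟨ #below-step R i ⟩
    #meeting R i + #below (suc R) i
      ≡⟨ cong₂ _+_ refl (trans (∑∈-cong (allSubsets N) λ S → ⟦⟧-false (dominatingBelow? (suc R) S ×-dec (∣ S ∣ ≟ i)) (empty S ∘ proj₁))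
           (∑∈-0 (allSubsets N))) ⟩
    #meeting R i + 0
      ≡⟨ +-identityʳ _ ⟩
    #meeting R i
      ≡⟨ #meeting≡ R 2+2R≤α i ⟩
    ∑₁ i (λ a → (size (ρ R) chosen C a) * binom (+ size (ρ R) free) (+ i - + a - + size (ρ R) forced))
      ≡⟨ ∑₁-cong i (λ {a} _ _ → trans
           (cong₂ _*_ (cong (_C a) (size-chosen R 2+2R≤α))
             (trans (cong₂ (λ m f → binom (+ m) f) (∑-zero λ x → ⟦⟧-false (ρ R x ≟ᶠ free) none-free)
                      (trans (sub-sub i a (size (ρ R) forced)) (cong (λ f → i ⊖ (a + f)) (size-forced R 2R<α))))
                    (binom-0-⊖ i (a + ∑₁ R level))))
           (*-⟦⟧ (i ≟ a + ∑₁ R level) (level (α ∸ suc R) C a))) ⟩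
    ∑₁ i (λ a → when (i ≟ a + ∑₁ R level) (binom (+ level (α ∸ suc R)) (+ a))) ∎))
    where
    open ≡-Reasoning
    2+2R≤α : suc R + suc R ≤ α
    2+2R≤α = ≤-reflexive (sym α≡)
    2R<α : R + R < α
    2R<α = 2r<α R 2+2R≤α
    *-⟦⟧ : (P? : Dec P) → ∀ m → m * ⟦ P? ⟧ ≡ when P? m
    *-⟦⟧ (yes _) m = *-identityʳ m
    *-⟦⟧ (no _)  m = *-zeroʳ m
    none-free : ∀ {x} → ρ R x ≢ free
    none-free eq with ρ-spec-≡ R eq
    ... | is-free R<y lt = <⇒≱ lt (subst (_≤ _) (sym α≡) (+-monoˡ-≤ (suc R) R<y))
    -- A vertex `w` of the middle level lies outside such an `S` and could only be dominated from
    -- level at least R + 1, which `S` misses.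
    empty : ∀ S → ¬ DominatingBelow (suc R) S
    empty S ((_ , dom) , below) with dom w (⇒∈V (subst (1 ≤_) (sym ℓw≡) (s≤s z≤n)) (subst₂ _<_ (sym ℓw≡) (sym α≡) (m<m+n (suc R) (s≤s z≤n))))
      (λ w∈S → <⇒≢ (below w w∈S) (trans (cong (_+ suc R) ℓw≡) (sym α≡)))
    ... | u , u∈S , w~u = <⇒≱ (below u u∈S) (≤-trans (~⇒ w~u) (≤-reflexive (trans (cong (_+ ℓ u) ℓw≡) (+-comm (suc R) (ℓ u)))))

-- Zero-divisors modulo a prime power

∑-ones : ∀ n → ∑[ x < n ] 1 ≡ n
∑-ones zero    = refl
∑-ones (suc n) = cong suc (∑-ones n)

-- Reconciles the range 1, ..., n used by `φ` with the residues 0, ..., n - 1.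
∑-shift : ∀ n (g : ℕ → ℕ) → ∑[ x < n ] g (suc (toℕ x)) + g 0 ≡ ∑[ x < n ] g (toℕ x) + g n
∑-shift zero    g = refl
∑-shift (suc n) g = begin
  g 1 + ∑[ x < n ] g (suc (suc (toℕ x))) + g 0   ≡⟨ cong (_+ g 0) (trans (+-comm (g 1) _) (∑-shift n (g ∘ suc))) ⟩
  ∑[ x < n ] g (suc (toℕ x)) + g (suc n) + g 0   ≡⟨ trans (+-comm _ (g 0)) (sym (+-assoc (g 0) _ (g (suc n)))) ⟩
  g 0 + ∑[ x < n ] g (suc (toℕ x)) + g (suc n)   ∎
  where open ≡-Reasoning

∑-multiples : ∀ d .{{_ : NonZero d}} M → ∑[ x < M * d ] ⟦ d ∣? toℕ x ⟧ ≡ M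
∑-multiples d M = begin
  ∑[ x < M * d ] ⟦ d ∣? toℕ x ⟧
    ≡⟨ sum-cong-≗ {M * d} (λ x → ∑-unique (d ∣? toℕ x) (λ y → toℕ y * d ≟ toℕ x) (exists x)
         (λ {y} eq → divides (toℕ y) (sym eq))
         (λ p q → toℕ-injective (*-cancelʳ-≡ _ _ d (trans p (sym q))))) ⟩
  ∑[ x < M * d ] ∑[ y < M ] ⟦ toℕ y * d ≟ toℕ x ⟧
    ≡⟨ ∑-comm {M * d} {M} (λ x y → ⟦ toℕ y * d ≟ toℕ x ⟧) ⟩
  ∑[ y < M ] ∑[ x < M * d ] ⟦ toℕ y * d ≟ toℕ x ⟧
    ≡⟨ sum-cong-≗ {M} (λ y → trans (∑-≟-toℕ (toℕ y * d) (M * d)) (⟦⟧-true (toℕ y * d <? M * d) (*-monoˡ-< d (toℕ<n y)))) ⟩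
  ∑[ y < M ] 1
    ≡⟨ ∑-ones M ⟩
  M ∎
  where
  open ≡-Reasoning
  exists : ∀ (x : Fin (M * d)) → d ∣ toℕ x → ∃ λ (y : Fin M) → toℕ y * d ≡ toℕ x
  exists x (divides q eq) = fromℕ< q<M , trans (cong (_* d) (toℕ-fromℕ< q<M)) (sym eq)
    where
    q<M : q < M
    q<M = *-cancelʳ-< d q M (subst (_< M * d) eq (toℕ<n x))

^-monoʳ-∣ : ∀ p {a b} → a ≤ b → p ^ a ∣ p ^ b
^-monoʳ-∣ p {a} {b} a≤b = divides (p ^ (b ∸ a)) (trans (cong (p ^_) (sym (m∸n+n≡m a≤b))) (^-distribˡ-+-* p (b ∸ a) a))

coprime-* : ∀ {k a b} → Coprime k a → Coprime k b → Coprime k (a * b)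
coprime-* k⊥a k⊥b (d∣k , d∣ab) = k⊥b (d∣k , coprime-divisor (λ (e∣d , e∣a) → k⊥a (∣-trans e∣d d∣k , e∣a)) d∣ab)

does⇒ : (P? : Dec P) → does P? ≡ true → P
does⇒ (yes p) _ = p

module PrimePower (p : ℕ) (p-prime : Prime p) where

  private instance
    p≢0 : NonZero p
    p≢0 = prime⇒nonZero p-prime

  -- Totients of prime powers and valuations.

  1<p : 1 < p
  1<p = nonTrivial⇒n>1 p {{prime⇒nonTrivial p-prime}}

  p^-mono-< : ∀ {a b} → a < b → p ^ a < p ^ b
  p^-mono-< = ^-monoʳ-< p 1<p

  -- Each of 1, ..., p^(j+1) is either coprime to p^(j+1) or one of the p^j multiples of `p`. The
  -- additive form allows the cancellation in `level≡φ`.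
  φ-prime-power : ∀ j → p ^ suc j ≡ φ (p ^ suc j) + p ^ j
  φ-prime-power j = begin
    q
      ≡⟨ ∑-ones q ⟨
    ∑[ x < q ] 1
      ≡⟨ sum-cong-≗ {q} (λ x → pointwise (suc (toℕ x))) ⟩
    ∑[ x < q ] (⟦ coprime? (suc (toℕ x)) q ⟧ + ⟦ p ∣? suc (toℕ x) ⟧)
      ≡⟨ ∑-distrib-+ {q} (λ x → ⟦ coprime? (suc (toℕ x)) q ⟧) _ ⟩
    ∑[ x < q ] ⟦ coprime? (suc (toℕ x)) q ⟧ + ∑[ x < q ] ⟦ p ∣? suc (toℕ x) ⟧
      ≡⟨ cong₂ _+_ (sym φ≡) multiples ⟩
    φ q + p ^ j ∎
    where
    open ≡-Reasoning
    q = p ^ suc j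
    φ≡ : φ q ≡ ∑[ x < q ] ⟦ coprime? (suc (toℕ x)) q ⟧
    φ≡ = trans (length-filter (λ k → coprime? k q) (applyUpTo suc q))
      (trans (cong List.sum (map-applyUpTo suc (λ k → ⟦ coprime? k q ⟧) q)) (sum-applyUpTo (λ k → ⟦ coprime? (suc k) q ⟧) q))
    multiples : ∑[ x < q ] ⟦ p ∣? suc (toℕ x) ⟧ ≡ p ^ j
    multiples = +-cancelʳ-≡ 1 _ _ (begin
      ∑[ x < q ] ⟦ p ∣? suc (toℕ x) ⟧ + 1              ≡⟨ cong₂ _+_ refl (sym (⟦⟧-true (p ∣? 0) (p ∣0))) ⟩
      ∑[ x < q ] ⟦ p ∣? suc (toℕ x) ⟧ + ⟦ p ∣? 0 ⟧    ≡⟨ ∑-shift q (λ x → ⟦ p ∣? x ⟧) ⟩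
      ∑[ x < q ] ⟦ p ∣? toℕ x ⟧ + ⟦ p ∣? q ⟧          ≡⟨ cong₂ _+_
        (trans (cong (λ n → ∑[ x < n ] ⟦ p ∣? toℕ x ⟧) (*-comm p (p ^ j))) (∑-multiples p (p ^ j)))
        (⟦⟧-true (p ∣? q) (m∣m*n (p ^ j))) ⟩
      p ^ j + 1 ∎)
    not-both : ∀ {k} → ¬ (Coprime k q × p ∣ k)
    not-both (k⊥q , p∣k) = <⇒≢ 1<p (sym (k⊥q (p∣k , m∣m*n (p ^ j))))
    coprime : ∀ {k} → ¬ (p ∣ k) → ∀ j → Coprime k (p ^ j)
    coprime p∤k zero    (_ , d∣1) = ∣1⇒≡1 d∣1
    coprime {k} p∤k (suc j) = coprime-* {k} {p} (λ (d∣k , d∣p) → case d∣k (prime⇒irreducible p-prime d∣p)) (coprime p∤k j)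
      where
      case : ∀ {d} → d ∣ k → d ≡ 1 ⊎ d ≡ p → d ≡ 1
      case d∣k (inj₁ d≡1)  = d≡1
      case d∣k (inj₂ refl) = contradiction d∣k p∤k
    pointwise : ∀ k → 1 ≡ ⟦ coprime? k q ⟧ + ⟦ p ∣? k ⟧
    pointwise k with p ∣? k
    ... | yes p∣k = sym (cong (_+ 1) (⟦⟧-false (coprime? k q) λ k⊥q → not-both (k⊥q , p∣k)))
    ... | no p∤k = sym (trans (+-identityʳ _) (⟦⟧-true (coprime? k q) (coprime p∤k (suc j))))

  -- The p-adic valuation of x, capped at a; in particular ν a 0 = a.
  ν : ℕ → ℕ → ℕ
  ν zero    x = 0
  ν (suc a) x = if does (p ^ suc a ∣? x) then suc a else ν a x

  p^ν∣ : ∀ a x → p ^ ν a x ∣ x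
  p^ν∣ zero    x = 1∣ x
  p^ν∣ (suc a) x with p ^ suc a ∣? x
  ... | yes d = d
  ... | no _  = p^ν∣ a x

  ν≤ : ∀ a x → ν a x ≤ a
  ν≤ zero    x = z≤n
  ν≤ (suc a) x with p ^ suc a ∣? x
  ... | yes _ = ≤-refl
  ... | no _  = m≤n⇒m≤1+n (ν≤ a x)

  ≤ν⇒∣ : ∀ {k a x} → k ≤ ν a x → p ^ k ∣ x
  ≤ν⇒∣ {k} {a} {x} k≤ν = ∣-trans (^-monoʳ-∣ p k≤ν) (p^ν∣ a x)

  ∣⇒≤ν : ∀ {k a x} → k ≤ a → p ^ k ∣ x → k ≤ ν a x
  ∣⇒≤ν {a = zero}      k≤a d = k≤a
  ∣⇒≤ν {k} {suc a} {x} k≤a d with p ^ suc a ∣? x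
  ... | yes _ = k≤a
  ... | no ¬d = ∣⇒≤ν (≤-pred (≤∧≢⇒< k≤a λ { refl → ¬d d })) d

  -- After cancelling p^(a+b), Euclid's lemma makes `p` divide one of the cofactors, contradicting
  -- exactness of the corresponding power.
  exact-* : ∀ {a b x y} → p ^ a ∣ x → ¬ (p ^ suc a ∣ x) → p ^ b ∣ y → ¬ (p ^ suc b ∣ y) →
            ¬ (p ^ suc (a + b) ∣ x * y)
  exact-* {a} {b} (divides x′ refl) x-exact (divides y′ refl) y-exact d
    with euclidsLemma x′ y′ p-prime (*-cancelʳ-∣ (p ^ (a + b)) {{m^n≢0 p (a + b)}} (subst (p ^ suc (a + b) ∣_) rearranged d))
    where
    rearranged : x′ * p ^ a * (y′ * p ^ b) ≡ x′ * y′ * p ^ (a + b)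
    rearranged = trans (interchange *-commutativeSemigroup x′ (p ^ a) y′ (p ^ b))
      (cong (x′ * y′ *_) (sym (^-distribˡ-+-* p a b)))
  ... | inj₁ p∣x′ = x-exact (*-monoˡ-∣ (p ^ a) p∣x′)
  ... | inj₂ p∣y′ = y-exact (*-monoˡ-∣ (p ^ b) p∣y′)

  ≤ν+ν⇒∣ : ∀ {a x y} → a ≤ ν a x + ν a y → p ^ a ∣ x * y
  ≤ν+ν⇒∣ {a} {x} {y} h = ∣-trans (^-monoʳ-∣ p h)
    (subst (_∣ x * y) (sym (^-distribˡ-+-* p (ν a x) (ν a y))) (*-pres-∣ (p^ν∣ a x) (p^ν∣ a y)))

  -- If the sum were below `a`, neither valuation would reach the cap; both would be exact, and
  -- `exact-*` would bound the power of `p` dividing the product.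
  ∣⇒≤ν+ν : ∀ {a x y} → p ^ a ∣ x * y → a ≤ ν a x + ν a y
  ∣⇒≤ν+ν {a} {x} {y} d = ≮⇒≥ λ lt → exact-* {ν a x} {ν a y} (p^ν∣ a x)
    (λ d′ → 1+n≰n (∣⇒≤ν (≤-trans (s≤s (m≤m+n (ν a x) (ν a y))) lt) d′)) (p^ν∣ a y)
    (λ d′ → 1+n≰n (∣⇒≤ν (≤-trans (s≤s (m≤n+m (ν a y) (ν a x))) lt) d′)) (∣-trans (^-monoʳ-∣ p lt) d)

  -- Valuations as levels of the zero-divisor graph.

  module _ (α′ : ℕ) where

    private
      α = suc α′
      N = p ^ α

    ℓ : Fin N → ℕ
    ℓ x = ν α (toℕ x)

    isZero·⇒ : ∀ (x y : Fin N) → IsZero (x · y) → α ≤ ℓ x + ℓ y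
    isZero·⇒ x y eq = ∣⇒≤ν+ν (m%n≡0⇒n∣m (toℕ x * toℕ y) N {{nonZeroIndex x}} (trans (sym (toℕ-fromℕ< _)) eq))

    ⇒isZero· : ∀ (x y : Fin N) → α ≤ ℓ x + ℓ y → IsZero (x · y)
    ⇒isZero· x y h = trans (toℕ-fromℕ< _) (n∣m⇒m%n≡0 (toℕ x * toℕ y) N {{nonZeroIndex x}} (≤ν+ν⇒∣ h))

    nonzero⇒ : ∀ (x : Fin N) → ¬ IsZero x → ℓ x < α
    nonzero⇒ x x≢0 = ≰⇒> λ α≤ℓ → <⇒≱ (toℕ<n x) (∣⇒≤ {{≢-nonZero x≢0}} (≤ν⇒∣ {a = α} α≤ℓ))

    ⇒nonzero : ∀ (x : Fin N) → ℓ x < α → ¬ IsZero x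
    ⇒nonzero x ℓ<α x≡0 = <⇒≱ ℓ<α (∣⇒≤ν ≤-refl (subst (N ∣_) (sym x≡0) (N ∣0)))

    ℓ-surjective : ∀ {k} → k < α → ∃ λ x → ℓ x ≡ k
    ℓ-surjective {k} k<α = fromℕ< p^k<N , trans (cong (ν α) (toℕ-fromℕ< p^k<N)) (≤-antisym
      (≮⇒≥ λ k<ν → <⇒≱ (p^-mono-< (n<1+n k)) (∣⇒≤ {{m^n≢0 p k}} (≤ν⇒∣ {a = α} k<ν)))
      (∣⇒≤ν (<⇒≤ k<α) ∣-refl))
      where
      p^k<N = p^-mono-< k<α

    -- If `x` had level 0, a `y` with x y = 0 would need level at least `α`, that is, y = 0.
    ∈V⇒ : ∀ {x} → x ∈ SimpleGraph.V (Γ N) → 1 ≤ ℓ x × ℓ x < α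
    ∈V⇒ {x} x∈V with does⇒ (isNonzeroZeroDivisor? x) (trans (sym (lookup∘tabulate _ x)) ([]=⇒lookup x∈V))
    ... | x≢0 , y , y≢0 , xy≡0 = n≢0⇒n>0 (λ ℓx≡0 → <⇒≱ (nonzero⇒ y y≢0) (subst (λ t → α ≤ t + ℓ y) ℓx≡0 (isZero·⇒ x y xy≡0))) ,
                                  nonzero⇒ x x≢0

    -- An element of level α - 1 is nonzero and annihilates everything of level at least 1.
    ⇒∈V : ∀ {x} → 1 ≤ ℓ x → ℓ x < α → x ∈ SimpleGraph.V (Γ N)
    ⇒∈V {x} 1≤ℓ ℓ<α with ℓ-surjective (n<1+n α′)
    ... | y , ℓy≡ = lookup⇒[]= x _ (trans (lookup∘tabulate _ x) (dec-true (isNonzeroZeroDivisor? x)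
      (⇒nonzero x ℓ<α , y , ⇒nonzero y (≤-reflexive (cong suc ℓy≡)) ,
       ⇒isZero· x y (subst (λ t → α ≤ ℓ x + t) (sym ℓy≡) (+-monoˡ-≤ α′ 1≤ℓ)))))

    ~⇒ : ∀ {u v} → SimpleGraph._~_ (Γ N) u v → α ≤ ℓ u + ℓ v
    ~⇒ {u} {v} (_ , uv≡0) = isZero·⇒ u v uv≡0

    ⇒~ : ∀ {u v} → u ≢ v → α ≤ ℓ u + ℓ v → SimpleGraph._~_ (Γ N) u v
    ⇒~ {u} {v} u≢v h = u≢v , ⇒isZero· u v h

    open Threshold (Γ N) α ℓ ∈V⇒ ⇒∈V ~⇒ ⇒~

    ∑-p^∣ : ∀ {k} → k ≤ α → ∑[ x < N ] ⟦ p ^ k ∣? toℕ x ⟧ ≡ p ^ (α ∸ k)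
    ∑-p^∣ {k} k≤α = trans
      (cong (λ n → ∑[ x < n ] ⟦ p ^ k ∣? toℕ x ⟧) (trans (cong (p ^_) (sym (m∸n+n≡m k≤α))) (^-distribˡ-+-* p (α ∸ k) k)))
      (∑-multiples (p ^ k) {{m^n≢0 p k}} (p ^ (α ∸ k)))

    -- A multiple of p^k has level exactly `k` or is a multiple of p^(k+1). Counting both kinds
    -- gives p^(α-k) as `level k` plus p^(α-k-1), and `φ-prime-power` writes it as a totient plus
    -- the same term.
    level≡φ : ∀ {k} → k < α → level k ≡ φ (p ^ (α ∸ k))
    level≡φ {k} k<α = +-cancelʳ-≡ (p ^ j) _ _ (begin
      level k + p ^ j
        ≡⟨ cong₂ _+_ refl (sym (∑-p^∣ k<α)) ⟩
      level k + ∑[ x < N ] ⟦ p ^ suc k ∣? toℕ x ⟧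
        ≡⟨ ∑-distrib-+ {N} (λ x → ⟦ ℓ x ≟ k ⟧) (λ x → ⟦ p ^ suc k ∣? toℕ x ⟧) ⟨
      ∑[ x < N ] (⟦ ℓ x ≟ k ⟧ + ⟦ p ^ suc k ∣? toℕ x ⟧)
        ≡⟨ sum-cong-≗ {N} (λ x → ⟦⟧-split (p ^ k ∣? toℕ x) (ℓ x ≟ k) (p ^ suc k ∣? toℕ x)
             (split x) (λ { refl → p^ν∣ α (toℕ x) }) (∣-trans (^-monoʳ-∣ p (n≤1+n k)))
             λ { (refl , d) → 1+n≰n (∣⇒≤ν k<α d) }) ⟨
      ∑[ x < N ] ⟦ p ^ k ∣? toℕ x ⟧
        ≡⟨ ∑-p^∣ (<⇒≤ k<α) ⟩
      p ^ (α ∸ k)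
        ≡⟨ cong (p ^_) α∸k≡ ⟩
      p ^ suc j
        ≡⟨ φ-prime-power j ⟩
      φ (p ^ suc j) + p ^ j
        ≡⟨ cong (λ t → φ (p ^ t) + p ^ j) α∸k≡ ⟨
      φ (p ^ (α ∸ k)) + p ^ j ∎)
      where
      open ≡-Reasoning
      j = α ∸ suc k
      α∸k≡ : α ∸ k ≡ suc j
      α∸k≡ = +-∸-assoc 1 k<α
      split : ∀ x → p ^ k ∣ toℕ x → ℓ x ≡ k ⊎ p ^ suc k ∣ toℕ x
      split x d with m≤n⇒m<n∨m≡n (∣⇒≤ν {a = α} (<⇒≤ k<α) d)
      ... | inj₁ k<ℓ = inj₂ (≤ν⇒∣ {a = α} k<ℓ)
      ... | inj₂ k≡ℓ = inj₁ (sym k≡ℓ)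

    -- From level sizes to totients.

    level-∸≡φ : ∀ {r} → 1 ≤ r → r ≤ α → level (α ∸ r) ≡ φ (p ^ r)
    level-∸≡φ 1≤r r≤α = trans (level≡φ (∸-monoʳ-< 1≤r r≤α)) (cong (λ t → φ (p ^ t)) (m∸[m∸n]≡n r≤α))

    A-φ : ℕ → ℕ → ℕ
    A-φ i R = ∑[1≤ r ≤ R ] ∑[1≤ a ≤ i ]
      (binom (+ φ (p ^ r)) (+ a)
       * binom (+ order (Γ N) - + φ (p ^ r) - + (∑[1≤ k ≤ r ∸ 1 ] (φ (p ^ k) + φ (p ^ (α ∸ k)))))
               (+ i - + a - + (∑[1≤ k ≤ r ∸ 1 ] φ (p ^ (α ∸ k)))))

    s-φ : ℕ → ℕ
    s-φ R = ∑[1≤ k ≤ R ] φ (p ^ (α ∸ k))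

    B-φ : ℕ → ℕ → ℕ
    B-φ i h = ∑[1≤ a ≤ i ] when (i ≟ a + s-φ (h ∸ 1)) (binom (+ φ (p ^ h)) (+ a))

    ∑A≡ : ∀ i {R} → R ≤ α → ∑₁ R (A i) ≡ A-φ i R
    ∑A≡ i {R} R≤α = ∑₁-cong R λ {r} 1≤r r≤R → ∑₁-cong i λ {a} _ _ →
      cong₂ _*_ (cong (λ c → binom (+ c) (+ a)) (level-∸≡φ 1≤r (≤-trans r≤R R≤α)))
        (cong₂ binom
          (cong₂ (λ c s → + order (Γ N) - + c - + s) (level-∸≡φ 1≤r (≤-trans r≤R R≤α))
            (∑₁-cong (r ∸ 1) λ 1≤k k≤r-1 → cong₂ _+_ (level-∸≡φ 1≤k (<⇒≤ (below r≤R 1≤r k≤r-1))) (level≡φ (below r≤R 1≤r k≤r-1))))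
          (cong (λ s → + i - + a - + s) (∑₁-cong (r ∸ 1) λ _ k≤r-1 → level≡φ (below r≤R 1≤r k≤r-1))))
      where
      below : ∀ {r k} → r ≤ R → 1 ≤ r → k ≤ r ∸ 1 → k < α
      below {suc r} r≤R _ k≤r = ≤-trans (s≤s k≤r) (≤-trans r≤R R≤α)

    ∑level≡ : ∀ {R} → R < α → ∑₁ R level ≡ s-φ R
    ∑level≡ {R} R<α = ∑₁-cong R λ _ k≤R → level≡φ (≤-<-trans k≤R R<α)

    d-Γ-odd : ∀ R → 1 ≤ R → α ≡ suc (R + R) → ∀ i → d (Γ N) i ≡ A-φ i R + ⟦ i ≟ s-φ R ⟧
    d-Γ-odd R 1≤R α≡ i = trans (d-odd R 1≤R α≡ (ℓ-surjective R<α) i)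
      (cong₂ (λ A s → A + ⟦ i ≟ s ⟧) (∑A≡ i (<⇒≤ R<α)) (∑level≡ R<α))
      where
      R<α : R < α
      R<α = subst (R <_) (sym α≡) (s≤s (m≤m+n R R))

    d-Γ-even : ∀ R → α ≡ suc R + suc R → ∀ i → d (Γ N) i ≡ A-φ i R + B-φ i (suc R)
    d-Γ-even R α≡ i = trans (d-even R α≡ (ℓ-surjective 1+R<α) i)
      (cong₂ _+_ (∑A≡ i (<⇒≤ R<α))
        (cong₂ (λ s c → ∑₁ i (λ a → when (i ≟ a + s) (binom (+ c) (+ a))))
          (∑level≡ R<α) (level-∸≡φ (s≤s z≤n) (<⇒≤ 1+R<α))))
      where
      1+R<α : suc R < α
      1+R<α = subst (suc R <_) (sym α≡) (m<m+n (suc R) (s≤s z≤n))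
      R<α : R < α
      R<α = <-trans (n<1+n R) 1+R<α

    -- The summation starts at `a = 1`, so i = a + s forces i > s. The single formula A + B thus
    -- reduces to A in the first even case.
    B-φ≡0 : ∀ i h → i ≤ s-φ (h ∸ 1) → B-φ i h ≡ 0
    B-φ≡0 i h i≤s = trans (∑₁≡∑ i summand) (∑-zero {i} λ a → when-false (i ≟ suc (toℕ a) + s) λ i≡ →
      <⇒≢ (≤-<-trans i≤s (s≤s (m≤n+m s (toℕ a)))) i≡)
      where
      s = s-φ (h ∸ 1)
      summand : ℕ → ℕ
      summand a = when (i ≟ a + s) (binom (+ φ (p ^ h)) (+ a))
      when-false : (P? : Dec P) → ¬ P → ∀ {m} → when P? m ≡ 0
      when-false P? ¬p {m} = cong (if_then m else 0) (dec-false P? ¬p)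

theorem3p7 :
  (p α : ℕ) → Prime p → p > 2 → α > 2 →
  let n = order (Γ (p ^ α)) in
  (i : ℕ) → i ≤ n →
  ( ¬ (2 ∣ α) →
    let A = ∑[1≤ r ≤ α / 2 ] ∑[1≤ a ≤ i ]
              (binom (+ φ (p ^ r)) (+ a)
               * binom (+ n - + φ (p ^ r) - + (∑[1≤ k ≤ r ∸ 1 ] (φ (p ^ k) + φ (p ^ (α ∸ k)))))
                       (+ i - + a - + (∑[1≤ k ≤ r ∸ 1 ] φ (p ^ (α ∸ k)))))
        s = ∑[1≤ k ≤ α / 2 ] φ (p ^ (α ∸ k))
    in (i ≡ s → d (Γ (p ^ α)) i ≡ A + 1)
     × (i ≢ s → d (Γ (p ^ α)) i ≡ A) )
  ×
  ( 2 ∣ α →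
    let A = ∑[1≤ r ≤ α / 2 ∸ 1 ] ∑[1≤ a ≤ i ]
              (binom (+ φ (p ^ r)) (+ a)
               * binom (+ n - + φ (p ^ r) - + (∑[1≤ k ≤ r ∸ 1 ] (φ (p ^ k) + φ (p ^ (α ∸ k)))))
                       (+ i - + a - + (∑[1≤ k ≤ r ∸ 1 ] φ (p ^ (α ∸ k)))))
        s = ∑[1≤ k ≤ α / 2 ∸ 1 ] φ (p ^ (α ∸ k))
        B = ∑[1≤ a ≤ i ] when (i ≟ a + s) (binom (+ φ (p ^ (α / 2))) (+ a))
    in (i ≤ s → d (Γ (p ^ α)) i ≡ A)
     × (¬ (i ≤ s) → d (Γ (p ^ α)) i ≡ A + B) )
theorem3p7 p zero      p-prime p>2 () i i≤n
theorem3p7 p α@(suc α′) p-prime p>2 α>2 i i≤n =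
  (λ 2∤α → let d≡ = d-Γ-odd α′ (α / 2) (1≤⌊⌋ 2∤α) (α≡2⌊⌋+1 2∤α) i in
    (λ i≡s → trans d≡ (cong₂ _+_ refl (⟦⟧-true (i ≟ s-φ α′ (α / 2)) i≡s))) ,
    (λ i≢s → trans d≡ (trans (cong₂ _+_ refl (⟦⟧-false (i ≟ s-φ α′ (α / 2)) i≢s)) (+-identityʳ (A-φ α′ i (α / 2)))))) ,
  (λ 2∣α → let d≡ = even (α / 2) (α≡2⌊⌋ 2∣α) in
    (λ i≤s → trans d≡ (trans (cong₂ _+_ refl (B-φ≡0 α′ i (α / 2) i≤s)) (+-identityʳ (A-φ α′ i (α / 2 ∸ 1))))) ,
    (λ _ → d≡))
  where
  open PrimePower p p-prime

  double : ∀ R → R * 2 ≡ R + R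
  double R = trans (*-comm R 2) (cong₂ _+_ refl (+-identityʳ R))

  α≡2⌊⌋ : 2 ∣ α → α ≡ α / 2 + α / 2
  α≡2⌊⌋ 2∣α = trans (m≡m%n+[m/n]*n α 2) (trans (cong (_+ α / 2 * 2) (n∣m⇒m%n≡0 α 2 2∣α)) (double (α / 2)))

  α≡2⌊⌋+1 : ¬ (2 ∣ α) → α ≡ suc (α / 2 + α / 2)
  α≡2⌊⌋+1 2∤α = trans (m≡m%n+[m/n]*n α 2) (cong₂ _+_ α%2≡1 (double (α / 2)))
    where
    α%2≡1 : α % 2 ≡ 1
    α%2≡1 = ≤-antisym (≤-pred (m%n<n α 2)) (n≢0⇒n>0 (2∤α ∘ m%n≡0⇒n∣m α 2))

  1≤⌊⌋ : ¬ (2 ∣ α) → 1 ≤ α / 2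
  1≤⌊⌋ 2∤α = n≢0⇒n>0 λ ⌊⌋≡0 →
    <⇒≱ (≤-trans (s≤s (s≤s z≤n)) α>2) (≤-reflexive (trans (α≡2⌊⌋+1 2∤α) (cong (λ h → suc (h + h)) ⌊⌋≡0)))

  -- Generalising α/2 to `h` lets it be matched as a successor; `h = 0` is impossible because `α` is
  -- a successor.
  even : ∀ h → α ≡ h + h → d (Γ (p ^ α)) i ≡ A-φ α′ i (h ∸ 1) + B-φ α′ i h
  even (suc R) α≡ = d-Γ-even α′ R α≡ i
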